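{- Let $\Lambda=\langle|\Lambda|,<\rangle$ be a linear order, let $S\subseteq|\Lambda|$, and let $\phi$ be a formula of $\mathcal{L}_S$. Then $\mathsf{GLP}_\Lambda\vdash\phi$ if and only if $\mathsf{GLP}_S\vdash\phi$.
   Context: $\Lambda$ is an arbitrary (not necessarily well-founded) linear order; its elements are called modals. The language $\mathcal{L}_\Lambda$ is built from a countably infinite set of propositional variables and the constant $\top$ using $\neg,\wedge$ and a unary modality $[\alpha]$ for each $\alpha\in|\Lambda|$; $\langle\alpha\rangle$ abbreviates $\neg[\alpha]\neg$. $\mathsf{GLP}_\Lambda$ is the logic with axioms: all substitution instances of propositional tautologies and, for all $\alpha,\beta\in|\Lambda|$ and formulas $\chi,\psi$: (i) $[\alpha](\chi\to\psi)\to([\alpha]\chi\to[\alpha]\psi)$; (ii) $[\alpha]([\alpha]\chi\to\chi)\to[\alpha]\chi$; (iii) $[\alpha]\chi\to[\beta][\alpha]\chi$ for $\alpha\le\beta$; (iv) $\langle\alpha\rangle\chi\to[\beta]\langle\alpha\rangle\chi$ for $\alpha<\beta$; (v) $[\alpha]\chi\to[\beta]\chi$ for $\alpha\le\beta$; and rules modus ponens and necessitation $\chi/[\alpha]\chi$ for each $\alpha\in|\Lambda|$. For $S\subseteq|\Lambda|$, $\mathcal{L}_S$ is the sublanguage using only modalities $[\xi]$ with $\xi\in S$, and $\mathsf{GLP}_S$ is the logic obtained by restricting all axioms and rules of $\mathsf{GLP}_\Lambda$ to formulas of $\mathcal{L}_S$ (with the order on $S$ inherited from $\Lambda$). -}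

module Defs where

open import Level using (Level; _⊔_; 0ℓ)
open import Data.Nat using (ℕ)
open import Data.Bool using (Bool; true; false; not; _∧_)
open import Data.Unit.Polymorphic using (⊤)
open import Data.Product using (_×_)
open import Data.Sum using (_⊎_)
open import Relation.Binary.PropositionalEquality using (_≡_)
open import Relation.Binary.Structures using (IsStrictTotalOrder)

record LinearOrder (a ℓ : Level) : Set (Level.suc (a ⊔ ℓ)) where
  field
    Carrier            : Set a
    _<_                : Carrier → Carrier → Set ℓ
    isStrictTotalOrder : IsStrictTotalOrder _≡_ _<_

  _≤_ : Carrier → Carrier → Set (a ⊔ ℓ)
  x ≤ y = (x < y) ⊎ (x ≡ y)

data PForm : Set where
  pvar : ℕ → PForm
  p⊤   : PForm
  p¬   : PForm → PForm
  _p∧_ : PForm → PForm → PForm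

evalP : (ℕ → Bool) → PForm → Bool
evalP v (pvar n)  = v n
evalP v p⊤        = true
evalP v (p¬ t)    = not (evalP v t)
evalP v (t p∧ u)  = evalP v t ∧ evalP v u

Tautology : PForm → Set
Tautology t = (v : ℕ → Bool) → evalP v t ≡ true

module GLPLogic {a ℓ : Level} (Λ : LinearOrder a ℓ) where
  open LinearOrder Λ

  data Form : Set a where
    var  : ℕ → Form
    ⊤'   : Form
    ¬'_  : Form → Form
    _∧'_ : Form → Form → Form
    [_]_ : Carrier → Form → Form

  infixr 6 _∧'_
  infixr 5 _⇒_
  infix 8 ¬'_
  infix 8 [_]_ ⟨_⟩_

  _⇒_ : Form → Form → Form
  φ ⇒ ψ = ¬' (φ ∧' ¬' ψ)

  ⟨_⟩_ : Carrier → Form → Form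
  ⟨ α ⟩ φ = ¬' ([ α ] ¬' φ)

  substP : (ℕ → Form) → PForm → Form
  substP σ (pvar n) = σ n
  substP σ p⊤       = ⊤'
  substP σ (p¬ t)   = ¬' substP σ t
  substP σ (t p∧ u) = substP σ t ∧' substP σ u

  InL : ∀ {s} → (Carrier → Set s) → Form → Set s
  InL S (var n)   = ⊤
  InL S ⊤'        = ⊤
  InL S (¬' φ)    = InL S φ
  InL S (φ ∧' ψ)  = InL S φ × InL S ψ
  InL S ([ α ] φ) = S α × InL S φ

  data GLP {s} (S : Carrier → Set s) : Form → Set (a ⊔ ℓ ⊔ s) where
    taut  : ∀ {t} (σ : ℕ → Form) → Tautology t →
            InL S (substP σ t) → GLP S (substP σ t)
    ax-K  : ∀ α χ ψ → InL S ([ α ] (χ ⇒ ψ) ⇒ ([ α ] χ ⇒ [ α ] ψ)) →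
            GLP S ([ α ] (χ ⇒ ψ) ⇒ ([ α ] χ ⇒ [ α ] ψ))
    ax-L  : ∀ α χ → InL S ([ α ] ([ α ] χ ⇒ χ) ⇒ [ α ] χ) →
            GLP S ([ α ] ([ α ] χ ⇒ χ) ⇒ [ α ] χ)
    ax-3  : ∀ α β χ → α ≤ β → InL S ([ α ] χ ⇒ [ β ] [ α ] χ) →
            GLP S ([ α ] χ ⇒ [ β ] [ α ] χ)
    ax-4  : ∀ α β χ → α < β → InL S (⟨ α ⟩ χ ⇒ [ β ] ⟨ α ⟩ χ) →
            GLP S (⟨ α ⟩ χ ⇒ [ β ] ⟨ α ⟩ χ)
    ax-5  : ∀ α β χ → α ≤ β → InL S ([ α ] χ ⇒ [ β ] χ) →
            GLP S ([ α ] χ ⇒ [ β ] χ)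
    mp    : ∀ {χ ψ} → GLP S χ → GLP S (χ ⇒ ψ) → GLP S ψ
    nec   : ∀ {χ} α → InL S ([ α ] χ) → GLP S χ → GLP S ([ α ] χ)

  GLPΛ : Form → Set (a ⊔ ℓ)
  GLPΛ = GLP {0ℓ} (λ _ → ⊤)

-- Only finitely many modalities occur in a derivation, so S ⊆ T may be taken finite; induct on T.
-- Let t be the least element of T. On a plane, where all modalities other than t stay, formulas
-- [ t ] χ are constant, so a plane is given by truth values w χ for them and a formula δ without t.
-- A formula of 𝓛_S not provable in GLP_S is refuted in a finite tree of planes, by the usual
-- completeness argument for GL in the direction of t. This tree need not validate axiom (v),
-- [ t ] χ → [ β ] χ, for the formulas of a GLP_T-derivation. Below each plane one therefore inserts
-- finitely many further planes, each δ asserting [ min ] of the formulas that hold on all planes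
-- so far: this validates (v), and the values w decrease until they are stationary. At that
-- stage Löb's rule shows that those formulas are provable outright, so that the original plane
-- can be put on top. If t ∉ S the tree is a single plane.
module Submission where

open import Defs
open import Level using (Level; _⊔_)
open import Data.Bool using (Bool; true; false; not; _∧_; if_then_else_)
open import Data.Bool.Properties using (∧-zeroʳ; ¬-not)
open import Data.Empty using (⊥; ⊥-elim)
open import Data.List using (List; []; _∷_; _++_; map; filter; foldr)
open import Data.List.Membership.Propositional using (_∈_)
open import Data.List.Membership.Propositional.Properties using (∈-map⁺; ∈-++⁺ˡ; ∈-++⁺ʳ; ∈-++⁻; ∈-filter⁺; ∈-filter⁻)
open import Data.List.Relation.Binary.Sublist.Propositional
  using (_⊆_; []; _∷ʳ_; _∷_; ⊆-refl; lookup)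
open import Data.List.Relation.Binary.Sublist.Propositional.Properties using (filter-⊆)
open import Data.List.Relation.Unary.All as All using (All; []; _∷_)
import Data.List.Relation.Unary.All.Properties as All
open import Data.List.Relation.Unary.AllPairs using (AllPairs; []; _∷_)
open import Data.List.Relation.Unary.Any using (here; there)
open import Data.Nat as ℕ using (ℕ; zero; suc)
open import Data.Nat.Induction using (Acc; acc; <-wellFounded)
import Data.Nat.Properties as ℕ
open import Data.Product using (Σ; _×_; _,_; proj₁; proj₂)
open import Data.Sum using (_⊎_; inj₁; inj₂)
open import Function using (_∘_; id)
open import Function.Bundles using (_⇔_; mk⇔)
open import Relation.Binary.PropositionalEquality
  using (_≡_; _≢_; refl; sym; trans; cong; cong₂; subst)
open import Relation.Binary.Definitions using (tri<; tri≈; tri>)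
open import Relation.Binary.Structures using (IsStrictTotalOrder)
open import Relation.Nullary using (¬_; Dec; yes; no; does)
open import Relation.Nullary.Decidable using (dec-true)

-- Booleans, finite search and counting.

bool-ext : ∀ {x y} → (x ≡ true → y ≡ true) → (y ≡ true → x ≡ true) → x ≡ y
bool-ext {true} {y} h k = sym (h refl)
bool-ext {false} {true} h k = k refl
bool-ext {false} {false} h k = refl

true≢false : ∀ {x} → x ≡ true → x ≡ false → ⊥
true≢false refl ()

bool-dichotomy : ∀ {c} {C : Set c} x → (x ≡ true → C) → (x ≡ false → C) → C
bool-dichotomy true h k = h refl
bool-dichotomy false h k = k refl

∧-intro : ∀ {x y} → x ≡ true → y ≡ true → x ∧ y ≡ true
∧-intro refl refl = refl

∧-left : ∀ {x y} → x ∧ y ≡ true → x ≡ true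
∧-left {true} _ = refl

∧-right : ∀ {x y} → x ∧ y ≡ true → y ≡ true
∧-right {true} p = p

-- Takes the place of excluded middle for quantifiers over a list, which keeps the countermodel
-- construction constructive.
search : ∀ {a p q} {A : Set a} {P : A → Set p} {Q : A → Set q} (l : List A) →
         (∀ {x} → x ∈ l → P x ⊎ Q x) →
         (Σ A λ x → x ∈ l × P x) ⊎ (∀ {x} → x ∈ l → Q x)
search [] h = inj₂ λ ()
search (x ∷ l) h with h (here refl) | search l (h ∘ there)
... | inj₁ p | _ = inj₁ (x , here refl , p)
... | inj₂ _ | inj₁ (y , y∈ , p) = inj₁ (y , there y∈ , p)
... | inj₂ q | inj₂ qs = inj₂ λ { (here refl) → q ; (there y∈) → qs y∈ }

count : ∀ {a} {A : Set a} → (A → Bool) → List A → ℕ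
count p [] = 0
count p (x ∷ l) = if p x then suc (count p l) else count p l

module _ {a} {A : Set a} {p q : A → Bool} where

  count-≤ : ∀ l → (∀ {x} → x ∈ l → p x ≡ true → q x ≡ true) → count p l ℕ.≤ count q l
  count-≤ [] h = ℕ.z≤n
  count-≤ (x ∷ l) h with p x | q x | h (here refl) | count-≤ l (h ∘ there)
  ... | true  | true  | _ | le = ℕ.s≤s le
  ... | true  | false | k | _ with k refl
  ...   | ()
  count-≤ (x ∷ l) h | false | true  | _ | le = ℕ.m≤n⇒m≤1+n le
  count-≤ (x ∷ l) h | false | false | _ | le = le

  -- The decreasing measure of both well-founded recursions: the one that stabilises a valuation and
  -- the one that builds the tree of planes.
  count-< : ∀ l → (∀ {x} → x ∈ l → p x ≡ true → q x ≡ true) →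
            ∀ {y} → y ∈ l → p y ≡ false → q y ≡ true → count p l ℕ.< count q l
  count-< (x ∷ l) h (here refl) px qx rewrite px | qx = ℕ.s≤s (count-≤ l (h ∘ there))
  count-< (x ∷ l) h (there y∈) py qy
    with p x | q x | h (here refl) | count-< l (h ∘ there) y∈ py qy
  ... | true  | true  | _ | lt = ℕ.s≤s lt
  ... | true  | false | k | _ with k refl
  ...   | ()
  count-< (x ∷ l) h (there y∈) py qy | false | true  | _ | lt = ℕ.m≤n⇒m≤1+n lt
  count-< (x ∷ l) h (there y∈) py qy | false | false | _ | lt = lt

module Conservativity {a ℓ : Level} (Λ : LinearOrder a ℓ) where
  open LinearOrder Λ
  open GLPLogic Λ
  open IsStrictTotalOrder isStrictTotalOrder using (_≟_; compare; irrefl; asym)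
    renaming (trans to <-trans)
  open import Data.List.Membership.DecPropositional _≟_ using (_∈?_)

  -- Decidable equality of formulas.

  _≟F_ : (φ ψ : Form) → Dec (φ ≡ ψ)
  var m ≟F var n with m ℕ.≟ n
  ... | yes refl = yes refl
  ... | no m≢n = no λ { refl → m≢n refl }
  ⊤' ≟F ⊤' = yes refl
  (¬' φ) ≟F (¬' ψ) with φ ≟F ψ
  ... | yes refl = yes refl
  ... | no φ≢ψ = no λ { refl → φ≢ψ refl }
  (φ ∧' χ) ≟F (ψ ∧' ξ) with φ ≟F ψ | χ ≟F ξ
  ... | yes refl | yes refl = yes refl
  ... | no φ≢ψ | _ = no λ { refl → φ≢ψ refl }
  ... | yes _ | no χ≢ξ = no λ { refl → χ≢ξ refl }
  ([ α ] φ) ≟F ([ β ] ψ) with α ≟ β | φ ≟F ψ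
  ... | yes refl | yes refl = yes refl
  ... | no α≢β | _ = no λ { refl → α≢β refl }
  ... | yes _ | no φ≢ψ = no λ { refl → φ≢ψ refl }
  var _ ≟F ⊤' = no λ ()
  var _ ≟F (¬' _) = no λ ()
  var _ ≟F (_ ∧' _) = no λ ()
  var _ ≟F ([ _ ] _) = no λ ()
  ⊤' ≟F var _ = no λ ()
  ⊤' ≟F (¬' _) = no λ ()
  ⊤' ≟F (_ ∧' _) = no λ ()
  ⊤' ≟F ([ _ ] _) = no λ ()
  (¬' _) ≟F var _ = no λ ()
  (¬' _) ≟F ⊤' = no λ ()
  (¬' _) ≟F (_ ∧' _) = no λ ()
  (¬' _) ≟F ([ _ ] _) = no λ ()
  (_ ∧' _) ≟F var _ = no λ ()
  (_ ∧' _) ≟F ⊤' = no λ ()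
  (_ ∧' _) ≟F (¬' _) = no λ ()
  (_ ∧' _) ≟F ([ _ ] _) = no λ ()
  ([ _ ] _) ≟F var _ = no λ ()
  ([ _ ] _) ≟F ⊤' = no λ ()
  ([ _ ] _) ≟F (¬' _) = no λ ()
  ([ _ ] _) ≟F (_ ∧' _) = no λ ()

  -- Propositional reasoning by truth values: variables and boxed formulas are atoms.

  ev : (Form → Bool) → Form → Bool
  ev f (var n)   = f (var n)
  ev f ⊤'        = true
  ev f (¬' φ)    = not (ev f φ)
  ev f (φ ∧' ψ)  = ev f φ ∧ ev f ψ
  ev f ([ α ] φ) = f ([ α ] φ)

  atoms : Form → List Form
  atoms (var n)   = var n ∷ []
  atoms ⊤'        = []
  atoms (¬' φ)    = atoms φ
  atoms (φ ∧' ψ)  = atoms φ ++ atoms ψ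
  atoms ([ α ] φ) = ([ α ] φ) ∷ []

  index : List Form → Form → ℕ
  index [] φ = zero
  index (ψ ∷ l) φ with φ ≟F ψ
  ... | yes _ = zero
  ... | no _  = suc (index l φ)

  nth : List Form → ℕ → Form
  nth [] _ = ⊤'
  nth (φ ∷ l) zero = φ
  nth (φ ∷ l) (suc n) = nth l n

  nth-index : ∀ {l φ} → φ ∈ l → nth l (index l φ) ≡ φ
  nth-index {ψ ∷ l} {φ} φ∈ with φ ≟F ψ
  nth-index _ | yes φ≡ψ = sym φ≡ψ
  nth-index (here φ≡ψ) | no φ≢ψ = ⊥-elim (φ≢ψ φ≡ψ)
  nth-index (there φ∈) | no _ = nth-index φ∈

  skeleton : (Form → ℕ) → Form → PForm
  skeleton i (var n)   = pvar (i (var n))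
  skeleton i ⊤'        = p⊤
  skeleton i (¬' φ)    = p¬ (skeleton i φ)
  skeleton i (φ ∧' ψ)  = skeleton i φ p∧ skeleton i ψ
  skeleton i ([ α ] φ) = pvar (i ([ α ] φ))

  substP-skeleton : ∀ l φ → (∀ {ψ} → ψ ∈ atoms φ → ψ ∈ l) →
                    substP (nth l) (skeleton (index l) φ) ≡ φ
  substP-skeleton l (var n) ⊆l = nth-index (⊆l (here refl))
  substP-skeleton l ⊤' ⊆l = refl
  substP-skeleton l (¬' φ) ⊆l = cong ¬'_ (substP-skeleton l φ ⊆l)
  substP-skeleton l (φ ∧' ψ) ⊆l =
    cong₂ _∧'_ (substP-skeleton l φ (⊆l ∘ ∈-++⁺ˡ))
               (substP-skeleton l ψ (⊆l ∘ ∈-++⁺ʳ (atoms φ)))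
  substP-skeleton l ([ α ] φ) ⊆l = nth-index (⊆l (here refl))

  evalP-skeleton : ∀ v i φ → evalP v (skeleton i φ) ≡ ev (v ∘ i) φ
  evalP-skeleton v i (var n) = refl
  evalP-skeleton v i ⊤' = refl
  evalP-skeleton v i (¬' φ) = cong not (evalP-skeleton v i φ)
  evalP-skeleton v i (φ ∧' ψ) = cong₂ _∧_ (evalP-skeleton v i φ) (evalP-skeleton v i ψ)
  evalP-skeleton v i ([ α ] φ) = refl

  -- A record keeps φ visible to unification; a bare equation about `ev f φ` would not determine it.
  record Holds (f : Form → Bool) (φ : Form) : Set where
    constructor hold
    field holds : ev f φ ≡ true
  open Holds

  module _ {f : Form → Bool} where
    ⊤I : Holds f ⊤'
    ⊤I = hold refl

    ∧I : ∀ {φ ψ} → Holds f φ → Holds f ψ → Holds f (φ ∧' ψ)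
    ∧I (hold p) (hold q) = hold (cong₂ _∧_ p q)

    ∧E₁ : ∀ {φ ψ} → Holds f (φ ∧' ψ) → Holds f φ
    ∧E₁ {φ} (hold p) with ev f φ in eq
    ... | true = hold eq

    ∧E₂ : ∀ {φ ψ} → Holds f (φ ∧' ψ) → Holds f ψ
    ∧E₂ {φ} (hold p) with ev f φ
    ... | true = hold p

    ¬I : ∀ {φ} → (Holds f φ → ⊥) → Holds f (¬' φ)
    ¬I {φ} h with ev f φ in eq
    ... | true = ⊥-elim (h (hold eq))
    ... | false = hold (cong not eq)

    ¬E : ∀ {φ} → Holds f (¬' φ) → Holds f φ → ⊥
    ¬E (hold p) (hold q) with trans (sym p) (cong not q)
    ... | ()

    raa : ∀ {φ} → (Holds f (¬' φ) → ⊥) → Holds f φ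
    raa {φ} h with ev f φ in eq
    ... | true = hold eq
    ... | false = ⊥-elim (h (hold (cong not eq)))

    ⇒I : ∀ {φ ψ} → (Holds f φ → Holds f ψ) → Holds f (φ ⇒ ψ)
    ⇒I h = ¬I λ p → ¬E (∧E₂ p) (h (∧E₁ p))

    ⇒E : ∀ {φ ψ} → Holds f (φ ⇒ ψ) → Holds f φ → Holds f ψ
    ⇒E h p = raa λ q → ¬E h (∧I p q)

  -- Truth constants, change of the set of modalities, derived rules.

  const : Bool → Form
  const true  = ⊤'
  const false = ¬' ⊤'

  const⁺ : ∀ {f b} → b ≡ true → Holds f (const b)
  const⁺ refl = ⊤I

  const⁻ : ∀ {f} b → Holds f (const b) → b ≡ true
  const⁻ true h = refl

  InL-const : ∀ {s} {S : Carrier → Set s} b → InL S (const b)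
  InL-const true = _
  InL-const false = _

  module _ {ℓS ℓR} {S : Carrier → Set ℓS} {R : Carrier → Set ℓR}
           (S⊆R : ∀ {α} → S α → R α) where

    InL-map : ∀ φ → InL S φ → InL R φ
    InL-map (var n) p = _
    InL-map ⊤' p = _
    InL-map (¬' φ) p = InL-map φ p
    InL-map (φ ∧' ψ) (p , q) = InL-map φ p , InL-map ψ q
    InL-map ([ α ] φ) (p , q) = S⊆R p , InL-map φ q

    -- The easy half of the equivalence, and the way derivations over a small list enter a larger
    -- one.
    GLP-map : ∀ {φ} → GLP S φ → GLP R φ
    GLP-map {φ} (taut {t} σ τ p) = taut {t = t} σ τ (InL-map φ p)
    GLP-map {φ} (ax-K α χ ψ p) = ax-K α χ ψ (InL-map φ p)
    GLP-map {φ} (ax-L α χ p) = ax-L α χ (InL-map φ p)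
    GLP-map {φ} (ax-3 α β χ α≤β p) = ax-3 α β χ α≤β (InL-map φ p)
    GLP-map {φ} (ax-4 α β χ α<β p) = ax-4 α β χ α<β (InL-map φ p)
    GLP-map {φ} (ax-5 α β χ α≤β p) = ax-5 α β χ α≤β (InL-map φ p)
    GLP-map (mp d e) = mp (GLP-map d) (GLP-map e)
    GLP-map {φ} (nec α p d) = nec α (InL-map φ p) (GLP-map d)

  InL? : ∀ {s} {S : Carrier → Set s} → (∀ α → Dec (S α)) → ∀ φ → Dec (InL S φ)
  InL? S? (var n) = yes _
  InL? S? ⊤' = yes _
  InL? S? (¬' φ) = InL? S? φ
  InL? S? (φ ∧' ψ) with InL? S? φ | InL? S? ψ
  ... | yes p | yes q = yes (p , q)
  ... | no ¬p | _ = no (¬p ∘ proj₁)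
  ... | yes _ | no ¬q = no (¬q ∘ proj₂)
  InL? S? ([ α ] φ) with S? α | InL? S? φ
  ... | yes p | yes q = yes (p , q)
  ... | no ¬p | _ = no (¬p ∘ proj₁)
  ... | yes _ | no ¬q = no (¬q ∘ proj₂)

  module _ {ℓS} {S : Carrier → Set ℓS} where

    GLP-InL : ∀ {φ} → GLP S φ → InL S φ
    GLP-InL (taut σ t p) = p
    GLP-InL (ax-K α χ ψ p) = p
    GLP-InL (ax-L α χ p) = p
    GLP-InL (ax-3 α β χ α≤β p) = p
    GLP-InL (ax-4 α β χ α<β p) = p
    GLP-InL (ax-5 α β χ α≤β p) = p
    GLP-InL (mp d e) = proj₂ (GLP-InL e)
    GLP-InL (nec α p d) = p

    -- The rule `taut` asks for a propositional template and a substitution. Numbering the atoms of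
    -- φ by their positions in `atoms φ` recovers both, so truth under all assignments is enough.
    tautology : ∀ {φ} → InL S φ → (∀ f → Holds f φ) → GLP S φ
    tautology {φ} p h = subst (GLP S) eq
      (taut {t = skeleton (index l) φ} (nth l) (λ v → trans (evalP-skeleton v (index l) φ) (holds (h (v ∘ index l))))
            (subst (InL S) (sym eq) p))
      where
      l = atoms φ
      eq = substP-skeleton l φ (λ z → z)

    -- Modus ponens discharges the premises one at a time until a tautology is left. All
    -- propositional steps below are done semantically through this rule.
    conseq : ∀ {Γ φ} → All (GLP S) Γ → InL S φ →
             (∀ f → All (Holds f) Γ → Holds f φ) → GLP S φ
    conseq [] p h = tautology p (λ f → h f [])
    conseq (d ∷ ds) p h =
      mp d (conseq ds (GLP-InL d , p) (λ f hs → ⇒I λ hd → h f (hd ∷ hs)))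

    weaken : ∀ {φ} ψ → InL S ψ → GLP S φ → GLP S (ψ ⇒ φ)
    weaken ψ p d = conseq (d ∷ []) (p , GLP-InL d) λ { f (h ∷ []) → ⇒I λ _ → h }

    ⇒-trans : ∀ {φ ψ χ} → GLP S (φ ⇒ ψ) → GLP S (ψ ⇒ χ) → GLP S (φ ⇒ χ)
    ⇒-trans d e = conseq (d ∷ e ∷ []) (proj₁ (GLP-InL d) , proj₂ (GLP-InL e))
      λ { f (h ∷ k ∷ []) → ⇒I (⇒E k ∘ ⇒E h) }

    K-mono : ∀ {α φ ψ} → S α → GLP S (φ ⇒ ψ) → GLP S ([ α ] φ ⇒ [ α ] ψ)
    K-mono {α} s d = mp (nec α (s , p , q) d) (ax-K α _ _ ((s , p , q) , (s , p) , (s , q)))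
      where
      p = proj₁ (GLP-InL d)
      q = proj₂ (GLP-InL d)

    K-mono₂ : ∀ {α φ ψ χ} → S α → GLP S (φ ⇒ (ψ ⇒ χ)) →
              GLP S ([ α ] φ ⇒ ([ α ] ψ ⇒ [ α ] χ))
    K-mono₂ {α} s d = ⇒-trans (K-mono s d) (ax-K α _ _ ((s , q , r) , (s , q) , (s , r)))
      where
      q = proj₁ (proj₂ (GLP-InL d))
      r = proj₂ (proj₂ (GLP-InL d))

    const-persist : ∀ {α} b → S α → GLP S (const b ⇒ [ α ] const b)
    const-persist {α} true s = weaken ⊤' _ (nec α (s , _) (tautology _ (λ f → ⊤I)))
    const-persist {α} false s = tautology (_ , s , _) (λ f → ⇒I λ h → ⊥-elim (¬E h ⊤I))

    not-const-persist : ∀ {α} b → S α → GLP S (¬' const b ⇒ [ α ] ¬' const b)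
    not-const-persist {α} false s =
      weaken (¬' const false) _ (nec α (s , _) (tautology _ (λ f → ¬I λ h → ¬E h ⊤I)))
    not-const-persist {α} true s = tautology (_ , s , _) (λ f → ⇒I λ h → ⊥-elim (¬E h ⊤I))

    -- Axiom (iv) for `¬' φ` speaks of the box of a double negation, which has to be removed under
    -- both boxes.
    not-box-persist : ∀ {α β} φ → α < β → S α → S β → InL S φ →
                      GLP S (¬' ([ α ] φ) ⇒ [ β ] ¬' ([ α ] φ))
    not-box-persist {α} {β} φ α<β sα sβ p =
      ⇒-trans (contrapose (K-mono sα nn⇒))
        (⇒-trans (ax-4 α β (¬' φ) α<β ((sα , p) , sβ , sα , p))
                 (K-mono sβ (contrapose (K-mono sα ⇒nn))))
      where
      contrapose : ∀ {χ ψ} → GLP S (χ ⇒ ψ) → GLP S (¬' ψ ⇒ ¬' χ)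
      contrapose d = conseq (d ∷ []) (proj₂ (GLP-InL d) , proj₁ (GLP-InL d))
        λ { f (h ∷ []) → ⇒I λ k → ¬I λ j → ¬E k (⇒E h j) }
      nn⇒ : GLP S (¬' ¬' φ ⇒ φ)
      nn⇒ = tautology (p , p) (λ f → ⇒I λ h → raa (¬E h))
      ⇒nn : GLP S (φ ⇒ ¬' ¬' φ)
      ⇒nn = tautology (p , p) (λ f → ⇒I λ h → ¬I λ k → ¬E k h)

  -- In a sorted list the head gives the weakest modality, and box implies all the others.
  box : List Carrier → Form → Form
  box [] φ      = ⊤'
  box (α ∷ _) φ = [ α ] φ

  -- Modal rules for the weakest box of a finite list.

  module _ {ℓS} {S : Carrier → Set ℓS} where

    InL-box : ∀ L → (∀ {α} → α ∈ L → S α) → ∀ {φ} → InL S φ → InL S (box L φ)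
    InL-box [] g p = _
    InL-box (α ∷ _) g p = g (here refl) , p

    box-mono : ∀ L → (∀ {α} → α ∈ L → S α) → ∀ {φ ψ} →
               GLP S (φ ⇒ ψ) → GLP S (box L φ ⇒ box L ψ)
    box-mono [] g d = tautology _ (λ f → ⇒I λ h → h)
    box-mono (α ∷ _) g d = K-mono (g (here refl)) d

    box-mono₂ : ∀ L → (∀ {α} → α ∈ L → S α) → ∀ {φ ψ χ} →
                GLP S (φ ⇒ (ψ ⇒ χ)) → GLP S (box L φ ⇒ (box L ψ ⇒ box L χ))
    box-mono₂ [] g d = tautology _ (λ f → ⇒I λ h → ⇒I λ h → h)
    box-mono₂ (α ∷ _) g d = K-mono₂ (g (here refl)) d

    box-nec : ∀ L → (∀ {α} → α ∈ L → S α) → ∀ {φ} → GLP S φ → GLP S (box L φ)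
    box-nec [] g d = tautology _ (λ f → ⊤I)
    box-nec (α ∷ _) g d = nec α (g (here refl) , GLP-InL d) d

    box-4 : ∀ L → (∀ {α} → α ∈ L → S α) → ∀ {φ} → InL S φ →
            GLP S (box L φ ⇒ box L (φ ∧' box L φ))
    box-4 [] g p = tautology _ (λ f → ⇒I λ h → h)
    box-4 L@(α ∷ _) g {φ} p =
      conseq (K-mono₂ s pair ∷ ax-3 α α φ (inj₂ refl) ((s , p) , s , s , p) ∷ [])
        ((s , p) , s , p , s , p)
        λ { f (h ∷ k ∷ []) → ⇒I λ b → ⇒E (⇒E h b) (⇒E k b) }
      where
      s = g (here refl)
      pair : GLP S (φ ⇒ ([ α ] φ ⇒ φ ∧' [ α ] φ))
      pair = tautology (p , (s , p) , p , s , p) (λ f → ⇒I λ x → ⇒I λ y → ∧I x y)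

    -- Löb's axiom, applied to the necessitated premise, yields `box L φ`, and the premise then
    -- yields φ. For the empty list the box is `⊤'`.
    box-löb : ∀ L → (∀ {α} → α ∈ L → S α) → ∀ {φ} → GLP S (box L φ ⇒ φ) → GLP S φ
    box-löb [] g d = conseq (d ∷ []) (proj₂ (GLP-InL d)) λ { f (h ∷ []) → ⇒E h ⊤I }
    box-löb (α ∷ _) g d =
      mp (mp (nec α (s , (s , p) , p) d) (ax-L α _ ((s , (s , p) , p) , s , p))) d
      where
      s = g (here refl)
      p = proj₂ (GLP-InL d)

    -- Löb's rule is applied to `ε ⇒ φ`: since ε implies its own box, the box of this implication
    -- together with ε gives `box L φ`.
    box-löb-under : ∀ L → (∀ {α} → α ∈ L → S α) → ∀ {ε φ} → GLP S (ε ⇒ box L ε) →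
                    GLP S (box L φ ∧' ε ⇒ φ) → GLP S (ε ⇒ φ)
    box-löb-under L g {ε} {φ} d e = box-löb L g
      (conseq (d ∷ e ∷ box-mono₂ L g mp' ∷ [])
        (InL-box L g (pε , pφ) , pε , pφ)
        λ { f (hd ∷ he ∷ hm ∷ []) → ⇒I λ b → ⇒I λ x →
              ⇒E he (∧I (⇒E (⇒E hm b) (⇒E hd x)) x) })
      where
      pε = proj₁ (GLP-InL d)
      pφ = proj₂ (GLP-InL e)
      mp' : GLP S ((ε ⇒ φ) ⇒ (ε ⇒ φ))
      mp' = tautology ((pε , pφ) , pε , pφ) (λ f → ⇒I λ h → h)

  -- Finite conjunctions selected by a valuation.

  conj : (Form → Bool) → (Form → Form) → List Form → Form
  conj u g [] = ⊤'
  conj u g (χ ∷ l) with u χ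
  ... | true  = g χ ∧' conj u g l
  ... | false = conj u g l

  conj⁺ : ∀ {f} u g l → (∀ {χ} → χ ∈ l → u χ ≡ true → Holds f (g χ)) → Holds f (conj u g l)
  conj⁺ u g [] h = ⊤I
  conj⁺ u g (χ ∷ l) h with u χ in eq
  ... | true  = ∧I (h (here refl) eq) (conj⁺ u g l (h ∘ there))
  ... | false = conj⁺ u g l (h ∘ there)

  conj⁻ : ∀ {f} u g l → Holds f (conj u g l) → ∀ {χ} → χ ∈ l → u χ ≡ true → Holds f (g χ)
  conj⁻ u g (χ ∷ l) h χ∈ uχ with u χ in eq
  conj⁻ u g (χ ∷ l) h (here refl) uχ | true = ∧E₁ h
  conj⁻ u g (χ ∷ l) h (there χ∈) uχ | true = conj⁻ u g l (∧E₂ h) χ∈ uχ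
  conj⁻ u g (χ ∷ l) h (here refl) uχ | false with trans (sym eq) uχ
  ... | ()
  conj⁻ u g (χ ∷ l) h (there χ∈) uχ | false = conj⁻ u g l h χ∈ uχ

  InL-conj : ∀ {s} {S : Carrier → Set s} u g l → (∀ {χ} → χ ∈ l → InL S (g χ)) →
             InL S (conj u g l)
  InL-conj u g [] h = _
  InL-conj u g (χ ∷ l) h with u χ
  ... | true  = h (here refl) , InL-conj u g l (h ∘ there)
  ... | false = InL-conj u g l (h ∘ there)

  conj-intro : ∀ {s} {S : Carrier → Set s} {ε} → InL S ε → ∀ u g l →
               (∀ {χ} → χ ∈ l → u χ ≡ true → GLP S (ε ⇒ g χ)) → GLP S (ε ⇒ conj u g l)
  conj-intro p u g [] h = tautology (p , _) (λ f → ⇒I λ _ → ⊤I)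
  conj-intro p u g (χ ∷ l) h with u χ in eq | conj-intro p u g l (h ∘ there)
  ... | false | d = d
  ... | true | d = conseq (h (here refl) eq ∷ d ∷ [])
    (p , proj₂ (GLP-InL (h (here refl) eq)) , proj₂ (GLP-InL d))
    λ { f (x ∷ y ∷ []) → ⇒I λ z → ∧I (⇒E x z) (⇒E y z) }

  box-conj : ∀ {r} {S : Carrier → Set r} L → (∀ {α} → α ∈ L → S α) → ∀ {ε} → InL S ε →
             ∀ u g l → (∀ {χ} → χ ∈ l → u χ ≡ true → GLP S (ε ⇒ box L (g χ))) →
             GLP S (ε ⇒ box L (conj u g l))
  box-conj L i p u g [] h = weaken _ p (box-nec L i (tautology _ (λ f → ⊤I)))
  box-conj {S = S} L i p u g (χ ∷ l) h with u χ in eq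
  ... | false = box-conj L i p u g l (h ∘ there)
  ... | true =
    pairing L i (h (here refl) eq) (box-conj L i p u g l (h ∘ there))
    where
    pairing : ∀ L → (∀ {α} → α ∈ L → S α) → ∀ {ε φ ψ} → GLP S (ε ⇒ box L φ) →
              GLP S (ε ⇒ box L ψ) → GLP S (ε ⇒ box L (φ ∧' ψ))
    pairing [] i d e = d
    pairing (α ∷ _) i {ε} {φ} {ψ} d e with GLP-InL d | GLP-InL e
    ... | pε , s , pφ | _ , _ , pψ =
      conseq (d ∷ e ∷ K-mono₂ s pair ∷ []) (pε , s , pφ , pψ)
        λ { f (hd ∷ he ∷ k ∷ []) → ⇒I λ x → ⇒E (⇒E k (⇒E hd x)) (⇒E he x) }
      where
      pair : GLP S (φ ⇒ (ψ ⇒ φ ∧' ψ))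
      pair = tautology (pφ , pψ , pφ , pψ) (λ f → ⇒I λ x → ⇒I λ y → ∧I x y)

  -- The head of a sorted list lies below every α in it, so axiom (v) carries the result of `box-4`
  -- to `[ α ]`.
  box-elim : ∀ {L} → AllPairs _<_ L → ∀ {φ} → InL (_∈ L) φ → ∀ {α} → α ∈ L →
             GLP (_∈ L) (box L φ ⇒ [ α ] (φ ∧' box L φ))
  box-elim {β ∷ L} (β<L ∷ _) {φ} p {α} α∈ =
    ⇒-trans (box-4 (β ∷ L) id p)
            (ax-5 β α _ (head-≤ α∈) ((b∈ , p , b∈ , p) , α∈ , p , b∈ , p))
    where
    b∈ : β ∈ β ∷ L
    b∈ = here refl
    head-≤ : ∀ {α} → α ∈ β ∷ L → β ≤ α
    head-≤ (here refl) = inj₂ refl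
    head-≤ (there α∈L) = inj₁ (All.lookup β<L α∈L)

  -- Arguments of the boxes occurring in a formula.

  bodies : Form → List Form
  bodies (var n)   = []
  bodies ⊤'        = []
  bodies (¬' φ)    = bodies φ
  bodies (φ ∧' ψ)  = bodies φ ++ bodies ψ
  bodies ([ α ] φ) = φ ∷ bodies φ

  bodies-trans : ∀ φ {χ ψ} → χ ∈ bodies φ → ψ ∈ bodies χ → ψ ∈ bodies φ
  bodies-trans (¬' φ) χ∈ ψ∈ = bodies-trans φ χ∈ ψ∈
  bodies-trans (φ ∧' ψ) χ∈ ψ∈ with ∈-++⁻ (bodies φ) χ∈
  ... | inj₁ χ∈φ = ∈-++⁺ˡ (bodies-trans φ χ∈φ ψ∈)
  ... | inj₂ χ∈ψ = ∈-++⁺ʳ (bodies φ) (bodies-trans ψ χ∈ψ ψ∈)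
  bodies-trans ([ α ] φ) (here refl) ψ∈ = there ψ∈
  bodies-trans ([ α ] φ) (there χ∈) ψ∈ = there (bodies-trans φ χ∈ ψ∈)

  InL-bodies : ∀ {s} {S : Carrier → Set s} φ → InL S φ → ∀ {χ} → χ ∈ bodies φ → InL S χ
  InL-bodies (¬' φ) p χ∈ = InL-bodies φ p χ∈
  InL-bodies (φ ∧' ψ) (p , q) χ∈ with ∈-++⁻ (bodies φ) χ∈
  ... | inj₁ χ∈φ = InL-bodies φ p χ∈φ
  ... | inj₂ χ∈ψ = InL-bodies ψ q χ∈ψ
  InL-bodies ([ α ] φ) (_ , p) (here refl) = p
  InL-bodies ([ α ] φ) (_ , p) (there χ∈) = InL-bodies φ p χ∈

  bodies-conj : ∀ u l {P : Form → Set a} → (∀ {χ ψ} → χ ∈ l → ψ ∈ bodies χ → P ψ) →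
                ∀ {ψ} → ψ ∈ bodies (conj u id l) → P ψ
  bodies-conj u (χ ∷ l) h ψ∈ with u χ
  ... | false = bodies-conj u l (h ∘ there) ψ∈
  ... | true with ∈-++⁻ (bodies χ) ψ∈
  ...   | inj₁ ψ∈χ = h (here refl) ψ∈χ
  ...   | inj₂ ψ∈l = bodies-conj u l (h ∘ there) ψ∈l

  -- Finitely many valuations, up to agreement on a list.

  update : Form → Bool → (Form → Bool) → Form → Bool
  update φ b u χ = if does (χ ≟F φ) then b else u χ

  valuations : List Form → List (Form → Bool)
  valuations []      = (λ _ → true) ∷ []
  valuations (φ ∷ l) = map (update φ true) (valuations l) ++ map (update φ false) (valuations l)

  valuations-complete : ∀ (g : Form → Bool) l → Σ (Form → Bool) λ u →
                        u ∈ valuations l × (∀ {χ} → χ ∈ l → u χ ≡ g χ)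
  valuations-complete g [] = (λ _ → true) , here refl , λ ()
  valuations-complete g (φ ∷ l) with valuations-complete g l
  ... | u , u∈ , u≗g = update φ (g φ) u , member (g φ) , agrees
    where
    member : ∀ b → update φ b u ∈ valuations (φ ∷ l)
    member true  = ∈-++⁺ˡ (∈-map⁺ (update φ true) u∈)
    member false = ∈-++⁺ʳ (map (update φ true) (valuations l)) (∈-map⁺ (update φ false) u∈)
    agrees : ∀ {χ} → χ ∈ φ ∷ l → update φ (g φ) u χ ≡ g χ
    agrees {χ} χ∈ with χ ≟F φ
    agrees χ∈ | yes refl = refl
    agrees (here χ≡φ) | no χ≢φ = ⊥-elim (χ≢φ χ≡φ)
    agrees (there χ∈) | no _ = u≗g χ∈

  -- Elimination of one modality in favour of truth constants.

  collapse : Carrier → (Form → Bool) → Form → Form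
  collapse t w (var n)  = var n
  collapse t w ⊤'       = ⊤'
  collapse t w (¬' φ)   = ¬' collapse t w φ
  collapse t w (φ ∧' ψ) = collapse t w φ ∧' collapse t w ψ
  collapse t w ([ α ] φ) with α ≟ t
  -- The valuation is consulted at the uncollapsed φ, so it is a function on formulas that may still
  -- contain t.
  ... | yes _ = const (w φ)
  ... | no _  = [ α ] collapse t w φ

  collapse-box : ∀ {t α} w φ → α ≢ t → collapse t w ([ α ] φ) ≡ [ α ] collapse t w φ
  collapse-box {t} {α} w φ α≢t with α ≟ t
  ... | yes α≡t = ⊥-elim (α≢t α≡t)
  ... | no _    = refl

  collapse-box-const : ∀ t w φ → collapse t w ([ t ] φ) ≡ const (w φ)
  collapse-box-const t w φ with t ≟ t
  ... | yes _ = refl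
  ... | no t≢t = ⊥-elim (t≢t refl)

  collapse-substP : ∀ t w σ τ → collapse t w (substP σ τ) ≡ substP (collapse t w ∘ σ) τ
  collapse-substP t w σ (pvar n) = refl
  collapse-substP t w σ p⊤ = refl
  collapse-substP t w σ (p¬ τ) = cong ¬'_ (collapse-substP t w σ τ)
  collapse-substP t w σ (τ p∧ υ) =
    cong₂ _∧'_ (collapse-substP t w σ τ) (collapse-substP t w σ υ)

  collapse-conj : ∀ t w u g l → collapse t w (conj u g l) ≡ conj u (collapse t w ∘ g) l
  collapse-conj t w u g [] = refl
  collapse-conj t w u g (χ ∷ l) with u χ
  ... | true  = cong (collapse t w (g χ) ∧'_) (collapse-conj t w u g l)
  ... | false = collapse-conj t w u g l

  -- Every formula at which `collapse` consults the valuation belongs to `bodies φ`.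
  collapse-cong : ∀ t {w u} φ → (∀ {χ} → χ ∈ bodies φ → w χ ≡ u χ) →
                  collapse t w φ ≡ collapse t u φ
  collapse-cong t (var n) h = refl
  collapse-cong t ⊤' h = refl
  collapse-cong t (¬' φ) h = cong ¬'_ (collapse-cong t φ h)
  collapse-cong t (φ ∧' ψ) h =
    cong₂ _∧'_ (collapse-cong t φ (h ∘ ∈-++⁺ˡ)) (collapse-cong t ψ (h ∘ ∈-++⁺ʳ (bodies φ)))
  collapse-cong t ([ α ] φ) h with α ≟ t
  ... | yes _ = cong const (h (here refl))
  ... | no _  = cong ([ α ]_) (collapse-cong t φ (h ∘ there))

  collapse-id : ∀ {s} {S : Carrier → Set s} t w φ → (∀ {α} → S α → α ≢ t) → InL S φ →
                collapse t w φ ≡ φ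
  collapse-id t w (var n) t∉ p = refl
  collapse-id t w ⊤' t∉ p = refl
  collapse-id t w (¬' φ) t∉ p = cong ¬'_ (collapse-id t w φ t∉ p)
  collapse-id t w (φ ∧' ψ) t∉ (p , q) =
    cong₂ _∧'_ (collapse-id t w φ t∉ p) (collapse-id t w ψ t∉ q)
  collapse-id t w ([ α ] φ) t∉ (p , q) with α ≟ t
  ... | yes α≡t = ⊥-elim (t∉ p α≡t)
  ... | no _    = cong ([ α ]_) (collapse-id t w φ t∉ q)

  InL-collapse : ∀ {t L} w φ → InL (_∈ t ∷ L) φ → InL (_∈ L) (collapse t w φ)
  InL-collapse w (var n) p = _
  InL-collapse w ⊤' p = _
  InL-collapse w (¬' φ) p = InL-collapse w φ p
  InL-collapse w (φ ∧' ψ) (p , q) = InL-collapse w φ p , InL-collapse w ψ q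
  InL-collapse {t} w ([ α ] φ) (p , q) with α ≟ t
  InL-collapse w ([ α ] φ) (p , q) | yes _ = InL-const (w φ)
  InL-collapse w ([ α ] φ) (here α≡t , q) | no α≢t = ⊥-elim (α≢t α≡t)
  InL-collapse w ([ α ] φ) (there p , q) | no _ = p , InL-collapse w φ q

  -- Axiom (v) is the only axiom whose validity on a plane depends on the particular formula, so a
  -- plane has to take care of just these finitely many.
  ax5-bodies : ∀ {s} {S : Carrier → Set s} {φ} → GLP S φ → List Form
  ax5-bodies (ax-5 α β χ α≤β p) = χ ∷ []
  ax5-bodies (mp d e) = ax5-bodies d ++ ax5-bodies e
  ax5-bodies (nec α p d) = ax5-bodies d
  ax5-bodies _ = []

  InL-ax5-bodies : ∀ {s} {S : Carrier → Set s} {φ} (d : GLP S φ) → All (InL S) (ax5-bodies d)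
  InL-ax5-bodies (taut σ τ p) = []
  InL-ax5-bodies (ax-K α χ ψ p) = []
  InL-ax5-bodies (ax-L α χ p) = []
  InL-ax5-bodies (ax-3 α β χ α≤β p) = []
  InL-ax5-bodies (ax-4 α β χ α<β p) = []
  InL-ax5-bodies (ax-5 α β χ α≤β p) = proj₂ (proj₁ p) ∷ []
  InL-ax5-bodies (mp d e) = All.++⁺ (InL-ax5-bodies d) (InL-ax5-bodies e)
  InL-ax5-bodies (nec α p d) = InL-ax5-bodies d

  -- Planes for the least modality t, and their soundness.

  module Collapse (t : Carrier) (T : List Carrier)
                  (t<T : All (t <_) T) (T-sorted : AllPairs _<_ T) where

    ⊢_ ⊢⁺_ : Form → Set (a ⊔ ℓ)
    ⊢ φ  = GLP (_∈ T) φ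
    ⊢⁺ φ = GLP (_∈ t ∷ T) φ
    infix 4 ⊢_ ⊢⁺_

    _* : (Form → Bool) → Form → Form
    w * = collapse t w

    -- w χ is the truth value of [ t ] χ, not of χ.
    record Valuation (Φ : List Form) (w : Form → Bool) : Set (a ⊔ ℓ) where
      field
        distrib : ∀ {χ ψ} → w (χ ⇒ ψ) ≡ true → w χ ≡ true → w ψ ≡ true
        4-axiom : ∀ {χ} → w χ ≡ true → w ([ t ] χ) ≡ true
        löb     : ∀ {χ} → w ([ t ] χ ⇒ χ) ≡ true → w χ ≡ true
        theorem : ∀ {χ} (d : ⊢⁺ χ) → All (_∈ Φ) (ax5-bodies d) → w χ ≡ true

    -- The formula δ describes the root of a plane, and `hereditary` spreads it over the plane.
    -- `monotone` is what axiom (v) demands when it leads from t to a larger modality.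
    record Plane (Φ : List Form) (w : Form → Bool) (δ : Form) : Set (a ⊔ ℓ) where
      field
        inL       : InL (_∈ T) δ
        hereditary : ∀ {α} → α ∈ T → ⊢ δ ⇒ [ α ] δ
        monotone  : ∀ {χ} → χ ∈ Φ → w χ ≡ true → ∀ {α} → α ∈ T → ⊢ δ ⇒ [ α ] (w *) χ

    private
      <-min : ∀ {α} → α < t → ¬ α ∈ t ∷ T
      <-min α<t (here refl) = irrefl refl α<t
      <-min α<t (there α∈) = asym α<t (All.lookup t<T α∈)

      ≤-min : ∀ {α} → α ≤ t → α ≢ t → ¬ α ∈ t ∷ T
      ≤-min (inj₁ α<t) α≢t = <-min α<t
      ≤-min (inj₂ α≡t) α≢t = ⊥-elim (α≢t α≡t)

      in-tail : ∀ {α} → α ≢ t → α ∈ t ∷ T → α ∈ T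
      in-tail α≢t (here α≡t) = ⊥-elim (α≢t α≡t)
      in-tail α≢t (there α∈) = α∈

    -- Axioms without t as a displayed modality keep their form under `collapse`; those for t alone
    -- become closure conditions on w. In (iii) and (iv) from t to a larger modality the collapsed
    -- box is a constant, which persists; (v) in that direction uses `monotone`. Steps down to t
    -- cannot occur because t is least. Necessitation by t is the field `theorem`.
    soundness : ∀ {Φ w δ} → Valuation Φ w → Plane Φ w δ →
                ∀ {φ} (d : ⊢⁺ φ) → All (_∈ Φ) (ax5-bodies d) → ⊢ δ ⇒ (w *) φ
    soundness {Φ} {w} {δ} V P = sound
      where
      open Valuation V
      open Plane P

      triv : ∀ {φ} → ⊢ φ → ⊢ δ ⇒ φ
      triv = weaken δ inL

      sound : ∀ {φ} (d : ⊢⁺ φ) → All (_∈ Φ) (ax5-bodies d) → ⊢ δ ⇒ (w *) φ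
      sound (taut {τ} σ h p) _ = triv
        (subst (GLP (_∈ T)) (sym eq)
          (taut {t = τ} (w * ∘ σ) h
            (subst (InL (_∈ T)) eq (InL-collapse w (substP σ τ) p))))
        where eq = collapse-substP t w σ τ
      sound (ax-K α χ ψ p) _ with α ≟ t | InL-collapse w ([ α ] (χ ⇒ ψ) ⇒ ([ α ] χ ⇒ [ α ] ψ)) p
      ... | no _ | q = triv (ax-K α _ _ q)
      ... | yes _ | q = triv (tautology q λ f → ⇒I λ h → ⇒I λ k →
            const⁺ (distrib (const⁻ _ h) (const⁻ _ k)))
      sound (ax-L α χ p) _ with α ≟ t | InL-collapse w ([ α ] ([ α ] χ ⇒ χ) ⇒ [ α ] χ) p
      ... | no α≢t | q rewrite collapse-box w χ α≢t = triv (ax-L α _ q)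
      ... | yes refl | q = triv (tautology q λ f → ⇒I λ h → const⁺ (löb (const⁻ _ h)))
      sound (ax-3 α β χ α≤β p) _
        with α ≟ t | β ≟ t | InL-collapse w ([ α ] χ ⇒ [ β ] [ α ] χ) p
      ... | yes refl | yes refl | q = triv (tautology q λ f → ⇒I λ h → const⁺ (4-axiom (const⁻ _ h)))
      ... | yes refl | no β≢t | q rewrite collapse-box-const t w χ =
            triv (const-persist (w χ) (in-tail β≢t (proj₁ (proj₂ p))))
      ... | no α≢t | yes refl | q = ⊥-elim (≤-min α≤β α≢t (proj₁ (proj₁ p)))
      ... | no α≢t | no _ | q rewrite collapse-box w χ α≢t = triv (ax-3 α β _ α≤β q)
      sound (ax-4 α β χ α<β p) _
        with α ≟ t | β ≟ t | InL-collapse w (⟨ α ⟩ χ ⇒ [ β ] ⟨ α ⟩ χ) p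
      ... | _ | yes refl | q = ⊥-elim (<-min α<β (proj₁ (proj₁ p)))
      ... | yes refl | no β≢t | q rewrite collapse-box-const t w (¬' χ) =
            triv (not-const-persist (w (¬' χ)) (in-tail β≢t (proj₁ (proj₂ p))))
      ... | no α≢t | no _ | q rewrite collapse-box w (¬' χ) α≢t = triv (ax-4 α β _ α<β q)
      sound (ax-5 α β χ α≤β p) (χ∈ ∷ [])
        with α ≟ t | β ≟ t | InL-collapse w ([ α ] χ ⇒ [ β ] χ) p
      ... | yes refl | yes refl | q = triv (tautology q λ f → ⇒I id)
      ... | no α≢t | yes refl | q = ⊥-elim (≤-min α≤β α≢t (proj₁ (proj₁ p)))
      ... | no _ | no _ | q = triv (ax-5 α β _ α≤β q)
      ... | yes refl | no β≢t | q with w χ in eq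
      ...   | true = conseq (monotone χ∈ eq (in-tail β≢t (proj₁ (proj₂ p))) ∷ []) (inL , q)
                λ { f (h ∷ []) → ⇒I λ x → ⇒I λ _ → ⇒E h x }
      ...   | false = triv (tautology q λ f → ⇒I λ h → ⊥-elim (¬E h ⊤I))
      sound (mp d e) hs with All.++⁻ (ax5-bodies d) hs
      ... | hd , he = conseq (sound d hd ∷ sound e he ∷ [])
            (inL , proj₂ (proj₂ (GLP-InL (sound e he))))
            λ { f (h ∷ k ∷ []) → ⇒I λ x → ⇒E (⇒E k x) (⇒E h x) }
      sound (nec {χ} α p d) hs with α ≟ t | InL-collapse w ([ α ] χ) p
      ... | yes refl | q = triv (tautology q λ f → const⁺ (theorem d hs))
      ... | no α≢t | q = ⇒-trans (hereditary α∈) (K-mono α∈ (sound d hs))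
        where α∈ = in-tail α≢t (proj₁ p)

    -- The tree of planes: every [ t ] ψ false under u is refuted on a plane with more true boxes,
    -- restricted to the part where all χ with u χ = true hold.
    data Realisable (Ψ : List Form) (u : Form → Bool) : Set (a ⊔ ℓ) where
      realisable :
        (child : ∀ {ψ} → ψ ∈ Ψ → u ψ ≡ false → Form → Bool) →
        (∀ {ψ} (ψ∈ : ψ ∈ Ψ) (uψ : u ψ ≡ false) →
           ∀ {χ} → χ ∈ Ψ → u χ ≡ true → child ψ∈ uψ χ ≡ true) →
        (∀ {ψ} (ψ∈ : ψ ∈ Ψ) (uψ : u ψ ≡ false) → Realisable Ψ (child ψ∈ uψ)) →
        (∀ {ψ} (ψ∈ : ψ ∈ Ψ) (uψ : u ψ ≡ false) → let v = child ψ∈ uψ in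
           ¬ (⊢ box T (conj v (v *) Ψ) ⇒ (conj u (v *) Ψ ⇒ (v *) ψ))) →
        Realisable Ψ u

    -- Realising a tree of planes so that axiom (v) holds for a given derivation.

    module Tower
      (dec : ∀ φ → Dec (⊢ φ))
      (Φ Ψ : List Form)
      (Φ-InL : ∀ {χ} → χ ∈ Φ → InL (_∈ t ∷ T) χ)
      (Ψ-InL : ∀ {χ} → χ ∈ Ψ → InL (_∈ t ∷ T) χ)
      -- Valuations may change outside Ψ while the tower grows; this keeps the collapsed formulas of
      -- Ψ unchanged meanwhile.
      (Ψ-fixed : ∀ {w u} → (∀ {χ} → χ ∈ Ψ → w χ ≡ u χ) → ∀ {χ} → χ ∈ Ψ → (w *) χ ≡ (u *) χ)
      where

      Agree : (w u : Form → Bool) → Set a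
      Agree w u = ∀ {χ} → χ ∈ Ψ → w χ ≡ u χ

      Φ*-InL : ∀ w {χ} → χ ∈ Φ → InL (_∈ T) ((w *) χ)
      Φ*-InL w {χ} χ∈ = InL-collapse w χ (Φ-InL χ∈)

      Ψ*-InL : ∀ w {χ} → χ ∈ Ψ → InL (_∈ T) ((w *) χ)
      Ψ*-InL w {χ} χ∈ = InL-collapse w χ (Ψ-InL χ∈)

      -- Its box expresses, without t, what axiom (v) requires for the formulas of Ψ on a plane with
      -- values u.
      Γ : (Form → Bool) → Form
      Γ u = conj u (u *) Ψ

      Γ-InL : ∀ u → InL (_∈ T) (Γ u)
      Γ-InL u = InL-conj u (u *) Ψ (Ψ*-InL u)

      □_ Γ□ : Form → Form
      □ φ = box T φ
      Γ□ φ = φ ∧' □ φ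
      infix 8 □_

      □-InL : ∀ {φ} → InL (_∈ T) φ → InL (_∈ T) (□ φ)
      □-InL = InL-box T id

      -- The truth values of the [ t ] χ on a plane that sees the plane (w , δ) and all that it sees.
      refine : (Form → Bool) → Form → Form → Bool
      refine w δ χ = w χ ∧ does (dec (δ ⇒ (w *) χ))

      refine⁺ : ∀ {w δ χ} → w χ ≡ true → ⊢ δ ⇒ (w *) χ → refine w δ χ ≡ true
      refine⁺ {w} {δ} {χ} wχ d rewrite wχ = dec-true (dec (δ ⇒ (w *) χ)) d

      refine⁻ : ∀ {w δ χ} → refine w δ χ ≡ true → w χ ≡ true × ⊢ δ ⇒ (w *) χ
      refine⁻ {w} {δ} {χ} eq with w χ | dec (δ ⇒ (w *) χ)
      ... | true | yes d = refl , d

      refine-refuted : ∀ {w δ χ} → ¬ (⊢ δ ⇒ (w *) χ) → refine w δ χ ≡ false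
      refine-refuted {w} {δ} ¬d = ¬-not (¬d ∘ proj₂ ∘ refine⁻ {w} {δ})

      -- Each closure condition holds for w by assumption and on the plane by propositional
      -- reasoning or `soundness`. For Löb, w already makes `[ t ] χ` true, so the plane satisfies
      -- `[ t ] χ`, and the implication gives χ there.
      refine-valuation : ∀ {w δ} → Valuation Φ w → Plane Φ w δ → Valuation Φ (refine w δ)
      refine-valuation {w} {δ} V P = record
        { distrib = λ h k → let (wh , dh) = refine⁻ {w} {δ} h ; (wk , dk) = refine⁻ {w} {δ} k in
            refine⁺ {w} {δ} (distrib wh wk)
              (conseq (dh ∷ dk ∷ []) (inL , proj₂ (proj₂ (GLP-InL dh)))
                λ { f (x ∷ y ∷ []) → ⇒I λ z → ⇒E (⇒E x z) (⇒E y z) })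
        ; 4-axiom = λ {χ} h → refine⁺ {w} {δ} (4-axiom (proj₁ (refine⁻ {w} {δ} h)))
            (boxed (proj₁ (refine⁻ {w} {δ} h)))
        ; löb = λ {χ} h → let (wh , dh) = refine⁻ {w} {δ} h in
            refine⁺ {w} {δ} (löb wh)
              (conseq (dh ∷ boxed (löb wh) ∷ []) (inL , proj₂ (proj₂ (GLP-InL dh)))
                λ { f (x ∷ y ∷ []) → ⇒I λ z → ⇒E (⇒E x z) (⇒E y z) })
        ; theorem = λ d hs → refine⁺ {w} {δ} (theorem d hs) (soundness V P d hs)
        }
        where
        open Valuation V
        open Plane P
        boxed : ∀ {χ} → w χ ≡ true → ⊢ δ ⇒ (w *) ([ t ] χ)
        boxed {χ} wχ rewrite collapse-box-const t w χ | wχ = tautology (inL , _) (λ f → ⇒I λ _ → ⊤I)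

      meet-valuation : ∀ {w v} → Valuation Φ w → Valuation Φ v → Valuation Φ (λ χ → w χ ∧ v χ)
      meet-valuation {w} {v} W V = record
        { distrib = λ h k → ∧-intro (W.distrib (∧-left h) (∧-left k)) (V.distrib (∧-right h) (∧-right k))
        ; 4-axiom = λ h → ∧-intro (W.4-axiom (∧-left h)) (V.4-axiom (∧-right h))
        ; löb = λ h → ∧-intro (W.löb (∧-left h)) (V.löb (∧-right h))
        ; theorem = λ d hs → ∧-intro (W.theorem d hs) (V.theorem d hs)
        }
        where
        module W = Valuation W
        module V = Valuation V

      -- The values on a plane that sees no plane: every `[ t ] χ` is vacuously true.
      true-valuation : Valuation Φ (λ _ → true)
      true-valuation = record
        { distrib = λ _ _ → refl ; 4-axiom = λ _ → refl ; löb = λ _ → refl ; theorem = λ _ _ → refl }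

      -- Axiom (v) for all of Φ then follows from `□ Γ u`, a condition on Ψ alone, so the plane need
      -- assert nothing further about Φ.
      Forced : (w u : Form → Bool) → Set (a ⊔ ℓ)
      Forced w u = ∀ {χ} → χ ∈ Φ → w χ ≡ true → ⊢ Γ□ (Γ u) ⇒ (w *) χ

      Γ□-InL : ∀ u → InL (_∈ T) (Γ□ (Γ u))
      Γ□-InL u = Γ-InL u , □-InL (Γ-InL u)

      □Γ-box : ∀ u {α} → α ∈ T → ⊢ □ Γ u ⇒ [ α ] Γ□ (Γ u)
      □Γ-box u = box-elim T-sorted (Γ-InL u)

      Γ-collapse : ∀ {w u} → Agree w u → ∀ {χ} → χ ∈ Ψ → u χ ≡ true → ⊢ Γ u ⇒ (w *) χ
      Γ-collapse {w} {u} w≈u {χ} χ∈ uχ rewrite Ψ-fixed {w} {u} w≈u χ∈ =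
        tautology (Γ-InL u , Ψ*-InL u χ∈) (λ f → ⇒I λ h → conj⁻ u (u *) Ψ h χ∈ uχ)

      -- The plane with δ = □ Δ satisfies axiom (v) by the choice of δ. At a fixed point δ entails Δ,
      -- and Löb's rule removes the hypothesis □ Δ.
      stabilise : ∀ {u} w → Acc ℕ._<_ (count w Φ) → Valuation Φ w → Agree w u →
                  Σ (Form → Bool) λ v → Valuation Φ v × Agree v u × Forced v u
      stabilise {u} w (acc smaller) V w≈u = result
        where
        Δ = conj w (w *) Φ
        Δ-InL = InL-conj w (w *) Φ (Φ*-InL w)
        -- The first conjunct secures axiom (v) for Φ. The second makes the formulas of Ψ selected
        -- by u true on the new plane, so the values on Ψ do not drop.
        δ = □ Δ ∧' Γ□ (Γ u)
        δ-InL = □-InL Δ-InL , Γ□-InL u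

        □Δ-box : ∀ {α} → α ∈ T → ⊢ □ Δ ⇒ [ α ] (Δ ∧' □ Δ)
        □Δ-box = box-elim T-sorted Δ-InL

        Δ-elim : ∀ {χ} → χ ∈ Φ → w χ ≡ true → ⊢ Δ ⇒ (w *) χ
        Δ-elim χ∈ wχ = tautology (Δ-InL , Φ*-InL w χ∈)
          (λ f → ⇒I λ h → conj⁻ w (w *) Φ h χ∈ wχ)

        plane : Plane Φ w δ
        plane = record
          { inL = δ-InL
          ; hereditary = λ α∈ →
              conseq (□Δ-box α∈ ∷ □Γ-box u α∈ ∷ K-mono₂ α∈ combine ∷ [])
                (δ-InL , α∈ , δ-InL)
                λ { f (h ∷ k ∷ j ∷ []) → ⇒I λ x →
                    ⇒E (⇒E j (⇒E h (∧E₁ x))) (⇒E k (∧E₂ (∧E₂ x))) }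
          ; monotone = λ χ∈ wχ α∈ →
              conseq (□Δ-box α∈ ∷ K-mono α∈ (⇒-trans Δ-left (Δ-elim χ∈ wχ)) ∷ [])
                (δ-InL , α∈ , Φ*-InL w χ∈)
                λ { f (h ∷ k ∷ []) → ⇒I λ x → ⇒E k (⇒E h (∧E₁ x)) }
          }
          where
          Δ-left : ⊢ Δ ∧' □ Δ ⇒ Δ
          Δ-left = tautology ((Δ-InL , □-InL Δ-InL) , Δ-InL) (λ f → ⇒I ∧E₁)
          combine : ⊢ Δ ∧' □ Δ ⇒ (Γ□ (Γ u) ⇒ □ Δ ∧' Γ□ (Γ u))
          combine = tautology ((Δ-InL , □-InL Δ-InL) , Γ□-InL u , δ-InL)
            (λ f → ⇒I λ x → ⇒I λ y → ∧I (∧E₂ x) y)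

        w′ = refine w δ
        V′ = refine-valuation V plane

        w′≈u : Agree w′ u
        w′≈u {χ} χ∈ = bool-ext
          (λ h → trans (sym (w≈u χ∈)) (proj₁ (refine⁻ {w} {δ} {χ} h)))
          (λ uχ → refine⁺ {w} {δ} (trans (w≈u χ∈) uχ)
            (conseq (Γ-collapse {w} {u} w≈u χ∈ uχ ∷ []) (δ-InL , Ψ*-InL w χ∈)
              λ { f (h ∷ []) → ⇒I λ x → ⇒E h (∧E₁ (∧E₂ x)) }))

        result : Σ (Form → Bool) λ v → Valuation Φ v × Agree v u × Forced v u
        result with search {P = λ χ → w χ ≡ true × w′ χ ≡ false}
                           {Q = λ χ → w χ ≡ true → ⊢ δ ⇒ (w *) χ} Φ decide
          where
          decide : ∀ {χ} → χ ∈ Φ → (w χ ≡ true × w′ χ ≡ false) ⊎ (w χ ≡ true → ⊢ δ ⇒ (w *) χ)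
          decide {χ} χ∈ with w χ | dec (δ ⇒ (w *) χ)
          ... | true | yes d = inj₂ λ _ → d
          ... | true | no _ = inj₁ (refl , refl)
          ... | false | _ = inj₂ λ ()
        -- A value on Φ drops from true to false, so the next round has a smaller count.
        ... | inj₁ (χ , χ∈ , wχ , w′χ) =
          stabilise w′ (smaller (count-< Φ (λ {χ} _ h → proj₁ (refine⁻ {w} {δ} {χ} h)) χ∈ w′χ wχ)) V′ w′≈u
        ... | inj₂ stable = w , V , (λ {χ} → w≈u {χ}) , λ χ∈ wχ → ⇒-trans Γ□⇒Δ (Δ-elim χ∈ wχ)
          where
          δ⇒Δ : ⊢ δ ⇒ Δ
          δ⇒Δ = conj-intro δ-InL w (w *) Φ stable
          Γ□⇒Δ : ⊢ Γ□ (Γ u) ⇒ Δ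
          -- The side hypothesis `Γ□ (Γ u)` implies its own box by `box-4`.
          Γ□⇒Δ = box-löb-under T id
            (conseq (box-4 T id (Γ-InL u) ∷ []) (Γ□-InL u , □-InL (Γ□-InL u))
              λ { f (h ∷ []) → ⇒I λ x → ⇒E h (∧E₂ x) })
            δ⇒Δ

      -- At the points below the root, `□ Γ u` yields `Γ□ (Γ u)`, hence ξ again and, by `Forced`,
      -- all that axiom (v) asks for. The parameter ξ lets the caller impose a condition at the
      -- root.
      top-plane : ∀ {w u ξ} → Forced w u → ⊢ Γ u ⇒ ξ → Plane Φ w (□ Γ u ∧' ξ)
      top-plane {w} {u} {ξ} forced d = record
        { inL = δ-InL
        ; hereditary = λ α∈ → conseq (□Γ-box u α∈ ∷ K-mono α∈ combine ∷ []) (δ-InL , α∈ , δ-InL)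
            λ { f (h ∷ k ∷ []) → ⇒I λ x → ⇒E k (⇒E h (∧E₁ x)) }
        ; monotone = λ χ∈ wχ α∈ →
            conseq (□Γ-box u α∈ ∷ K-mono α∈ (forced χ∈ wχ) ∷ [])
              (δ-InL , α∈ , proj₂ (GLP-InL (forced χ∈ wχ)))
              λ { f (h ∷ k ∷ []) → ⇒I λ x → ⇒E k (⇒E h (∧E₁ x)) }
        }
        where
        δ-InL = □-InL (Γ-InL u) , proj₂ (GLP-InL d)
        combine : ⊢ Γ□ (Γ u) ⇒ □ Γ u ∧' ξ
        combine = conseq (d ∷ []) (Γ□-InL u , δ-InL)
          λ { f (h ∷ []) → ⇒I λ x → ∧I (∧E₂ x) (⇒E h (∧E₁ x)) }

      -- By induction on the tree, every false `[ t ] ψ` gets a plane refuting ψ on top of its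
      -- realised child. The meet of the refined valuations belongs to a plane that sees all of
      -- these; it agrees with u on Ψ, and `stabilise` makes it forced.
      realise : ∀ {u} → Realisable Ψ u → Σ (Form → Bool) λ w → Valuation Φ w × Agree w u × Forced w u
      realise {u} (realisable child u≤child real refuted) =
        let (w , V , above , below) = meet Ψ id in
        stabilise w (<-wellFounded _) V
          (λ {χ} χ∈ → bool-ext
            (λ wχ → bool-dichotomy (u χ) id (λ uχ → ⊥-elim (true≢false wχ (below χ∈ uχ))))
            (above χ∈))
        where
        Below : (Form → Bool) → Set (a ⊔ ℓ)
        Below w = Valuation Φ w × (∀ {χ} → χ ∈ Ψ → u χ ≡ true → w χ ≡ true)

        refuter : ∀ {ψ} → ψ ∈ Ψ → u ψ ≡ false → Σ (Form → Bool) λ w → Below w × w ψ ≡ false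
        refuter {ψ} ψ∈ uψ with realise (real ψ∈ uψ)
        ... | w , V , w≈u′ , forced =
          refine w δ , (refine-valuation V (top-plane {w} {u′} forced Γ⇒ξ) , above) ,
          refine-refuted {w} {δ} λ d → refuted ψ∈ uψ
            (subst (λ φ → ⊢ □ Γ u′ ⇒ (ξ ⇒ φ)) (Ψ-fixed {w} {u′} w≈u′ ψ∈) (curry d))
          where
          u′ = child ψ∈ uψ
          -- The root of the refuting plane must satisfy each χ whose `[ t ] χ` is true under u, or
          -- else the plane above would lose that box.
          ξ = conj u (u′ *) Ψ
          δ = □ Γ u′ ∧' ξ
          ξ-InL = InL-conj u (u′ *) Ψ (Ψ*-InL u′)
          Γ⇒ξ : ⊢ Γ u′ ⇒ ξ
          Γ⇒ξ = tautology (Γ-InL u′ , ξ-InL) λ f → ⇒I λ h →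
            conj⁺ u (u′ *) Ψ λ χ∈ uχ → conj⁻ u′ (u′ *) Ψ h χ∈ (u≤child ψ∈ uψ χ∈ uχ)
          curry : ∀ {φ} → ⊢ δ ⇒ φ → ⊢ □ Γ u′ ⇒ (ξ ⇒ φ)
          curry d = conseq (d ∷ []) (□-InL (Γ-InL u′) , ξ-InL , proj₂ (GLP-InL d))
            λ { f (h ∷ []) → ⇒I λ x → ⇒I λ y → ⇒E h (∧I x y) }
          above : ∀ {χ} → χ ∈ Ψ → u χ ≡ true → refine w δ χ ≡ true
          above {χ} χ∈ uχ = refine⁺ {w} {δ} (trans (w≈u′ χ∈) (u≤child ψ∈ uψ χ∈ uχ))
            (subst (λ φ → ⊢ δ ⇒ φ) (sym (Ψ-fixed {w} {u′} w≈u′ χ∈))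
              (tautology ((□-InL (Γ-InL u′) , ξ-InL) , Ψ*-InL u′ χ∈)
                λ f → ⇒I λ h → conj⁻ u (u′ *) Ψ (∧E₂ h) χ∈ uχ))

        meet : ∀ l → (∀ {χ} → χ ∈ l → χ ∈ Ψ) → Σ (Form → Bool) λ w →
               Valuation Φ w × (∀ {χ} → χ ∈ Ψ → u χ ≡ true → w χ ≡ true) ×
               (∀ {χ} → χ ∈ l → u χ ≡ false → w χ ≡ false)
        meet [] l⊆Ψ = (λ _ → true) , true-valuation , (λ _ _ → refl) , λ ()
        meet (ψ ∷ l) l⊆Ψ with meet l (l⊆Ψ ∘ there) | u ψ in uψ
        ... | w , V , above , below | true = w , V , above , λ
          { (here refl) uψ′ → ⊥-elim (true≢false uψ uψ′) ; (there χ∈) → below χ∈ }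
        ... | w , V , above , below | false with refuter (l⊆Ψ (here refl)) uψ
        ... | v , (V′ , above′) , vψ =
          (λ χ → w χ ∧ v χ) , meet-valuation V V′ ,
          (λ χ∈ uχ → ∧-intro (above χ∈ uχ) (above′ χ∈ uχ)) , λ
          { (here refl) _ → trans (cong (w ψ ∧_) vψ) (∧-zeroʳ (w ψ))
          ; {χ} (there χ∈) uχ → cong (_∧ v χ) (below χ∈ uχ) }

      -- A plane with trivial root condition is put on the realised tree, and `soundness` is applied
      -- to it. This turns a derivation with t into one without t.
      descend : ∀ {u} → Realisable Ψ u → ∀ {φ} (d : ⊢⁺ φ) → All (_∈ Φ) (ax5-bodies d) →
                Σ (Form → Bool) λ w → Agree w u × ⊢ □ Γ u ⇒ (w *) φ
      descend {u} R d hs with realise R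
      ... | w , V , w≈u , forced = w , (λ {χ} → w≈u {χ}) ,
        conseq (soundness V (top-plane {w} {u} forced Γ⇒⊤) d hs ∷ [])
          (□-InL (Γ-InL u) , proj₂ (GLP-InL (soundness V (top-plane {w} {u} forced Γ⇒⊤) d hs)))
          λ { f (h ∷ []) → ⇒I λ x → ⇒E h (∧I x ⊤I) }
        where
        Γ⇒⊤ : ⊢ Γ u ⇒ ⊤'
        Γ⇒⊤ = tautology (Γ-InL u , _) (λ f → ⇒I λ _ → ⊤I)

    -- Completeness in the direction of t.

    module Completeness
      (S : List Carrier) (t<S : ∀ {α} → α ∈ S → t < α)
      -- The induction hypothesis of `conservative`, for the lists without t.
      (decide : ∀ χ φ → InL (_∈ S) χ → InL (_∈ S) φ →
                GLP (_∈ S) (box S χ ⇒ φ) ⊎ ¬ (⊢ box T χ ⇒ φ))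
      (Ψ : List Form)
      (Ψ-InL : ∀ {χ} → χ ∈ Ψ → InL (_∈ t ∷ S) χ)
      (Ψ-closed : ∀ {χ ψ} → χ ∈ Ψ → ψ ∈ bodies χ → ψ ∈ Ψ)
      where

      ⊩_ : Form → Set (a ⊔ ℓ)
      ⊩ φ = GLP (_∈ t ∷ S) φ
      infix 4 ⊩_

      InL⁺ : Form → Set a
      InL⁺ = InL (_∈ t ∷ S)

      t∈ : t ∈ t ∷ S
      t∈ = here refl

      □Ψ-InL : ∀ {χ} → χ ∈ Ψ → InL⁺ ([ t ] χ)
      □Ψ-InL χ∈ = t∈ , Ψ-InL χ∈

      yeas nays hat : (Form → Bool) → Form
      yeas u = conj u ([ t ]_) Ψ
      nays u = conj (not ∘ u) (λ χ → ¬' ([ t ] χ)) Ψ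
      hat u  = yeas u ∧' nays u

      hat-InL : ∀ u → InL⁺ (hat u)
      hat-InL u = InL-conj u _ Ψ □Ψ-InL , InL-conj (not ∘ u) _ Ψ □Ψ-InL

      hat⁺ : ∀ {f} u → (∀ {χ} → χ ∈ Ψ → u χ ≡ f ([ t ] χ)) → Holds f (hat u)
      hat⁺ u h = ∧I (conj⁺ u _ Ψ λ χ∈ uχ → hold (trans (sym (h χ∈)) uχ))
                    (conj⁺ (not ∘ u) _ Ψ λ χ∈ uχ → hold (trans (cong not (sym (h χ∈))) uχ))

      hat-yea : ∀ {f} u → Holds f (hat u) → ∀ {χ} → χ ∈ Ψ → u χ ≡ true → Holds f ([ t ] χ)
      hat-yea u h = conj⁻ u _ Ψ (∧E₁ h)

      hat-nay : ∀ {f} u → Holds f (hat u) → ∀ {χ} → χ ∈ Ψ → u χ ≡ false → Holds f (¬' ([ t ] χ))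
      hat-nay u h χ∈ uχ = conj⁻ (not ∘ u) _ Ψ (∧E₂ h) χ∈ (cong not uχ)

      hat⇒ : ∀ u {φ} → InL⁺ φ → (∀ f → Holds f (hat u) → Holds f φ) → ⊩ hat u ⇒ φ
      hat⇒ u p h = tautology (hat-InL u , p) (λ f → ⇒I (h f))

      only : ∀ {α} → α ∈ t ∷ S → ∀ {β} → β ∈ α ∷ [] → β ∈ t ∷ S
      only α∈ (here refl) = α∈

      -- Truth of `[ t ] χ` persists by axiom (iii), its falsity by axiom (iv).
      hat-persist : ∀ u {α} → α ∈ S → ⊩ hat u ⇒ [ α ] hat u
      hat-persist u {α} α∈ =
        conseq (persist u _ yea ∷ persist (not ∘ u) _ nay ∷
                K-mono₂ (there α∈) pair ∷ [])
          (hat-InL u , there α∈ , hat-InL u)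
          λ { f (h ∷ k ∷ j ∷ []) → ⇒I λ x → ⇒E (⇒E j (⇒E h x)) (⇒E k x) }
        where
        persist : ∀ v g →
                  (∀ {χ} → χ ∈ Ψ → v χ ≡ true → ⊩ hat u ⇒ [ α ] g χ) →
                  ⊩ hat u ⇒ [ α ] conj v g Ψ
        persist v g h = box-conj (α ∷ []) (only (there α∈)) (hat-InL u) v g Ψ h
        yea : ∀ {χ} → χ ∈ Ψ → u χ ≡ true → ⊩ hat u ⇒ [ α ] [ t ] χ
        yea {χ} χ∈ uχ = ⇒-trans (hat⇒ u (□Ψ-InL χ∈) (λ f h → hat-yea u h χ∈ uχ))
          (ax-3 t α χ (inj₁ (t<S α∈)) (□Ψ-InL χ∈ , there α∈ , □Ψ-InL χ∈))
        nay : ∀ {χ} → χ ∈ Ψ → not (u χ) ≡ true → ⊩ hat u ⇒ [ α ] ¬' ([ t ] χ)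
        nay {χ} χ∈ uχ =
          ⇒-trans (hat⇒ u (□Ψ-InL χ∈) (λ f h → conj⁻ (not ∘ u) _ Ψ (∧E₂ h) χ∈ uχ))
                  (not-box-persist χ (t<S α∈) t∈ (there α∈) (Ψ-InL χ∈))
        pair : ⊩ yeas u ⇒ (nays u ⇒ hat u)
        pair = tautology (proj₁ (hat-InL u) , proj₂ (hat-InL u) , hat-InL u)
          (λ f → ⇒I λ x → ⇒I λ y → ∧I x y)

      *-InL : ∀ u φ → InL⁺ φ → InL⁺ ((u *) φ)
      *-InL u φ p = InL-map there ((u *) φ) (InL-collapse u φ p)

      -- The state description `hat u` justifies replacing `[ t ] χ` by its value and, being
      -- persistent, remains available under the boxes of S. Both implications are proved together
      -- because negation exchanges them.
      collapse-correct : ∀ u φ → InL⁺ φ → (∀ {χ} → χ ∈ bodies φ → χ ∈ Ψ) →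
                         (⊩ hat u ⇒ (φ ⇒ (u *) φ)) × (⊩ hat u ⇒ ((u *) φ ⇒ φ))
      collapse-correct u (var n) p b⊆ = hat⇒ u _ (λ f _ → ⇒I id) , hat⇒ u _ (λ f _ → ⇒I id)
      collapse-correct u ⊤' p b⊆ = hat⇒ u _ (λ f _ → ⇒I id) , hat⇒ u _ (λ f _ → ⇒I id)
      collapse-correct u (¬' φ) p b⊆ with collapse-correct u φ p b⊆
      ... | d , e =
        conseq (e ∷ []) (hat-InL u , p , *-InL u φ p)
          (λ { f (h ∷ []) → ⇒I λ x → ⇒I λ y → ¬I λ z → ¬E y (⇒E (⇒E h x) z) }) ,
        conseq (d ∷ []) (hat-InL u , *-InL u φ p , p)
          (λ { f (h ∷ []) → ⇒I λ x → ⇒I λ y → ¬I λ z → ¬E y (⇒E (⇒E h x) z) })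
      collapse-correct u (φ ∧' ψ) (p , q) b⊆
        with collapse-correct u φ p (b⊆ ∘ ∈-++⁺ˡ) | collapse-correct u ψ q (b⊆ ∘ ∈-++⁺ʳ (bodies φ))
      ... | d , e | d′ , e′ =
        conseq (d ∷ d′ ∷ []) (hat-InL u , (p , q) , *-InL u φ p , *-InL u ψ q)
          (λ { f (h ∷ k ∷ []) → ⇒I λ x → ⇒I λ y →
             ∧I (⇒E (⇒E h x) (∧E₁ y)) (⇒E (⇒E k x) (∧E₂ y)) }) ,
        conseq (e ∷ e′ ∷ []) (hat-InL u , (*-InL u φ p , *-InL u ψ q) , p , q)
          (λ { f (h ∷ k ∷ []) → ⇒I λ x → ⇒I λ y →
             ∧I (⇒E (⇒E h x) (∧E₁ y)) (⇒E (⇒E k x) (∧E₂ y)) })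
      collapse-correct u ([ α ] φ) (p , q) b⊆ with α ≟ t
      ... | yes refl =
        hat⇒ u (□Ψ-InL φ∈ , InL-const (u φ)) (λ f h → ⇒I λ x →
          const⁺ (bool-dichotomy (u φ) id (λ uφ → ⊥-elim (¬E (hat-nay u h φ∈ uφ) x)))) ,
        hat⇒ u (InL-const (u φ) , □Ψ-InL φ∈) (λ f h → ⇒I λ x →
          hat-yea u h φ∈ (const⁻ (u φ) x))
        where φ∈ = b⊆ (here refl)
      collapse-correct u ([ α ] φ) (here α≡t , q) b⊆ | no α≢t = ⊥-elim (α≢t α≡t)
      collapse-correct u ([ α ] φ) (there α∈ , q) b⊆ | no α≢t
        with collapse-correct u φ q (b⊆ ∘ there)
      ... | d , e = under d , under e
        where
        under : ∀ {χ ψ} → ⊩ hat u ⇒ (χ ⇒ ψ) → ⊩ hat u ⇒ ([ α ] χ ⇒ [ α ] ψ)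
        under = ⇒-trans (hat-persist u α∈) ∘ K-mono₂ (there α∈)

      Γ : (Form → Bool) → Form
      Γ u = conj u (u *) Ψ

      -- Axiom (v) turns a true `[ t ] χ` into the box of χ for the head of L, and
      -- `collapse-correct` replaces χ under this box. The list is a separate argument so that one
      -- can split on it while S stays fixed.
      hat⇒□Γ : ∀ u L → (∀ {α} → α ∈ L → α ∈ S) → ⊩ hat u ⇒ box L (Γ u)
      hat⇒□Γ u L L⊆S = box-conj L (there ∘ L⊆S) (hat-InL u) u (u *) Ψ (boxed L L⊆S)
        where
        boxed : ∀ L → (∀ {α} → α ∈ L → α ∈ S) →
                ∀ {χ} → χ ∈ Ψ → u χ ≡ true → ⊩ hat u ⇒ box L ((u *) χ)
        boxed [] L⊆S χ∈ uχ = hat⇒ u _ (λ f _ → ⊤I)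
        boxed (α ∷ _) L⊆S {χ} χ∈ uχ =
          conseq (hat-persist u α∈ ∷
                  K-mono₂ (there α∈) (proj₁ (collapse-correct u χ (Ψ-InL χ∈) (Ψ-closed χ∈))) ∷
                  ax-5 t α χ (inj₁ (t<S α∈)) (□Ψ-InL χ∈ , there α∈ , Ψ-InL χ∈) ∷ [])
            (hat-InL u , there α∈ , *-InL u χ (Ψ-InL χ∈))
            λ { f (h ∷ k ∷ j ∷ []) → ⇒I λ x → ⇒E (⇒E k (⇒E h x)) (⇒E j (hat-yea u x χ∈ uχ)) }
          where α∈ = L⊆S (here refl)

      -- Reads a derivation found by the induction hypothesis back into the language with t.
      expand : ∀ u φ → InL⁺ φ → (∀ {χ} → χ ∈ bodies φ → χ ∈ Ψ) →
               GLP (_∈ S) (box S (Γ u) ⇒ (u *) φ) → ⊩ hat u ⇒ φ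
      expand u φ p b⊆ d =
        conseq (GLP-map there d ∷ hat⇒□Γ u S id ∷ proj₂ (collapse-correct u φ p b⊆) ∷ [])
          (hat-InL u , p)
          λ { f (h ∷ k ∷ j ∷ []) → ⇒I λ x → ⇒E (⇒E j x) (⇒E h (⇒E k x)) }

      -- Every assignment to the boxes `[ t ] χ` satisfies one of the listed state descriptions, so
      -- this is a propositional case distinction.
      split : ∀ {φ} → InL⁺ φ → (∀ {u} → u ∈ valuations Ψ → ⊩ hat u ⇒ φ) → ⊩ φ
      split {φ} p h = conseq (All.map⁺ {f = λ u → hat u ⇒ φ} (All.tabulate h)) p λ f hs →
        let (u , u∈ , u≗) = valuations-complete (λ χ → f ([ t ] χ)) Ψ in
        ⇒E (All.lookup (All.map⁻ hs) u∈) (hat⁺ u u≗)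

      Realisation : (u : Form → Bool) → Form → (Form → Bool) → Set (a ⊔ ℓ)
      Realisation u ψ v =
        (∀ {χ} → χ ∈ Ψ → u χ ≡ true → v χ ≡ true) × Realisable Ψ v ×
        ¬ (⊢ box T (Γ v) ⇒ (conj u (v *) Ψ ⇒ (v *) ψ))

      -- If no plane refutes [ t ] ψ over u then ⊩ facts ⇒ ([ t ] ψ ⇒ ψ), and Löb's axiom under
      -- hat u, which implies [ t ] facts, contradicts the falsity of [ t ] ψ.
      realisable? : ∀ u → Acc ℕ._<_ (count (not ∘ u) Ψ) → Realisable Ψ u ⊎ (⊩ ¬' hat u)
      realisable? u (acc smaller) = result
        where
        -- A successor plane must satisfy χ at its root and keep `[ t ] χ` true; both are needed in
        -- the choice of v below.
        facts = conj u (λ χ → χ ∧' [ t ] χ) Ψ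
        facts-InL = InL-conj u (λ χ → χ ∧' [ t ] χ) Ψ (λ χ∈ → Ψ-InL χ∈ , □Ψ-InL χ∈)

        goal : Form → Form
        goal ψ = facts ⇒ ([ t ] ψ ⇒ ψ)

        hat⇒□facts : ⊩ hat u ⇒ [ t ] facts
        hat⇒□facts = box-conj (t ∷ []) (only t∈) (hat-InL u) u _ Ψ λ χ∈ uχ →
          ⇒-trans (hat⇒ u (□Ψ-InL χ∈) (λ f h → hat-yea u h χ∈ uχ))
                  (box-4 (t ∷ []) (only t∈) (Ψ-InL χ∈))

        attempt : ∀ {ψ} → ψ ∈ Ψ → u ψ ≡ false → ∀ v → Realisation u ψ v ⊎ (⊩ hat v ⇒ goal ψ)
        attempt {ψ} ψ∈ uψ v with search {P = λ χ → u χ ≡ true × v χ ≡ false}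
                                        {Q = λ χ → u χ ≡ true → v χ ≡ true} Ψ compare′
          where
          compare′ : ∀ {χ} → χ ∈ Ψ → (u χ ≡ true × v χ ≡ false) ⊎ (u χ ≡ true → v χ ≡ true)
          compare′ {χ} _ with u χ | v χ
          ... | true  | true  = inj₂ id
          ... | true  | false = inj₁ (refl , refl)
          ... | false | _     = inj₂ λ ()
        ... | inj₁ (χ , χ∈ , uχ , vχ) = inj₂ (hat⇒ v (facts-InL , □Ψ-InL ψ∈ , Ψ-InL ψ∈)
              λ f h → ⇒I λ k → ⊥-elim (¬E (hat-nay v h χ∈ vχ) (∧E₂ (conj⁻ u _ Ψ k χ∈ uχ))))
        ... | inj₂ u≤v with v ψ in vψ
        ...   | false = inj₂ (hat⇒ v (facts-InL , □Ψ-InL ψ∈ , Ψ-InL ψ∈)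
              λ f h → ⇒I λ _ → ⇒I λ k → ⊥-elim (¬E (hat-nay v h ψ∈ vψ) k))
        -- As in the completeness proof of GL, the successor refutes ψ while making `[ t ] ψ` true,
        -- so it has strictly fewer false boxes than u.
        ...   | true with realisable? v (smaller (count-< Ψ fewer ψ∈ (cong not vψ) (cong not uψ)))
          where
          fewer : ∀ {χ} → χ ∈ Ψ → not (v χ) ≡ true → not (u χ) ≡ true
          fewer {χ} χ∈ ¬vχ with u χ in uχ
          ... | false = refl
          ... | true rewrite u≤v χ∈ uχ = ¬vχ
        ...     | inj₂ d = inj₂ (conseq (d ∷ []) (hat-InL v , facts-InL , □Ψ-InL ψ∈ , Ψ-InL ψ∈)
                  λ { f (h ∷ []) → ⇒I λ x → ⊥-elim (¬E h x) })
        ...     | inj₁ R with decide (Γ v) (conj u (v *) Ψ ⇒ (v *) ψ)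
                                (InL-conj v (v *) Ψ (λ {χ} χ∈ → InL-collapse v χ (Ψ-InL χ∈)))
                                (InL-conj u (v *) Ψ (λ {χ} χ∈ → InL-collapse v χ (Ψ-InL χ∈)) ,
                                 InL-collapse v ψ (Ψ-InL ψ∈))
        ...       | inj₂ ¬d = inj₁ (u≤v , R , ¬d)
        -- To be read back, the conjunction of collapsed formulas is first recognised as the
        -- collapse of a conjunction.
        ...       | inj₁ d = inj₂ (conseq (expand v (conj u id Ψ ⇒ ψ) (plain-InL , Ψ-InL ψ∈) b⊆
                      (subst (λ φ → GLP (_∈ S) (box S (Γ v) ⇒ (φ ⇒ (v *) ψ)))
                             (sym (collapse-conj t v u id Ψ)) d) ∷ [])
                      (hat-InL v , facts-InL , □Ψ-InL ψ∈ , Ψ-InL ψ∈)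
                      λ { f (h ∷ []) → ⇒I λ x → ⇒I λ y → ⇒I λ _ →
                          ⇒E (⇒E h x) (conj⁺ u id Ψ λ χ∈ uχ → ∧E₁ (conj⁻ u _ Ψ y χ∈ uχ)) })
          where
          plain-InL = InL-conj u id Ψ Ψ-InL
          b⊆ : ∀ {χ} → χ ∈ bodies (conj u id Ψ ⇒ ψ) → χ ∈ Ψ
          b⊆ χ∈ with ∈-++⁻ (bodies (conj u id Ψ)) χ∈
          ... | inj₁ χ∈conj = bodies-conj u Ψ Ψ-closed χ∈conj
          ... | inj₂ χ∈ψ = Ψ-closed ψ∈ χ∈ψ

        contradictory : ∀ {ψ} → ψ ∈ Ψ → u ψ ≡ false → ⊩ goal ψ → ⊩ ¬' hat u
        contradictory {ψ} ψ∈ uψ d =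
          conseq (hat⇒□facts ∷ K-mono t∈ d ∷
                  ax-L t ψ ((t∈ , □Ψ-InL ψ∈ , Ψ-InL ψ∈) , □Ψ-InL ψ∈) ∷ []) (hat-InL u)
            λ { f (h ∷ k ∷ l ∷ []) → ¬I λ x → ¬E (hat-nay u x ψ∈ uψ) (⇒E l (⇒E k (⇒E h x))) }

        resolve : ∀ {ψ} → ψ ∈ Ψ →
                  (⊩ ¬' hat u) ⊎ (u ψ ≡ false → Σ (Form → Bool) (Realisation u ψ))
        resolve {ψ} ψ∈ with u ψ in uψ
        ... | true = inj₂ λ ()
        ... | false with search (valuations Ψ) (λ {v} _ → attempt ψ∈ uψ v)
        ...   | inj₁ (v , _ , r) = inj₂ λ _ → v , r
        ...   | inj₂ d = inj₁ (contradictory ψ∈ uψ (split (facts-InL , □Ψ-InL ψ∈ , Ψ-InL ψ∈) d))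

        result : Realisable Ψ u ⊎ (⊩ ¬' hat u)
        result with search Ψ resolve
        ... | inj₁ (_ , _ , d) = inj₂ d
        ... | inj₂ r = inj₁ (realisable (λ ψ∈ uψ → proj₁ (r ψ∈ uψ))
                (λ ψ∈ uψ → proj₁ (proj₂ (r ψ∈ uψ)))
                (λ ψ∈ uψ → proj₁ (proj₂ (proj₂ (r ψ∈ uψ))))
                (λ ψ∈ uψ → proj₂ (proj₂ (proj₂ (r ψ∈ uψ)))))

      -- For each u, either `hat u` is inconsistent, or the collapse of φ follows from
      -- `box T (Γ u)`, or u gives a countermodel. If the last case never occurs, the state
      -- descriptions together prove φ.
      completeness : ∀ φ → InL⁺ φ → (∀ {χ} → χ ∈ bodies φ → χ ∈ Ψ) →
        (Σ (Form → Bool) λ u → Realisable Ψ u × ¬ (⊢ box T (Γ u) ⇒ (u *) φ)) ⊎ (⊩ φ)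
      completeness φ p b⊆ with search (valuations Ψ) (λ {u} _ → attempt u)
        where
        attempt : ∀ u → (Realisable Ψ u × ¬ (⊢ box T (Γ u) ⇒ (u *) φ)) ⊎ (⊩ hat u ⇒ φ)
        attempt u with realisable? u (<-wellFounded _)
        ... | inj₂ d = inj₂ (conseq (d ∷ []) (hat-InL u , p)
                λ { f (h ∷ []) → ⇒I λ x → ⊥-elim (¬E h x) })
        ... | inj₁ R with decide (Γ u) ((u *) φ)
                            (InL-conj u (u *) Ψ (λ {χ} χ∈ → InL-collapse u χ (Ψ-InL χ∈)))
                            (InL-collapse u φ p)
        ...   | inj₁ d = inj₂ (expand u φ p b⊆ d)
        ...   | inj₂ ¬d = inj₁ (R , ¬d)
      ... | inj₁ (u , _ , r) = inj₁ (u , r)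
      ... | inj₂ d = inj₂ (split p d)

  -- The base case without modalities: truth tables.

  ev-cong : ∀ {f g} φ → (∀ {χ} → χ ∈ atoms φ → f χ ≡ g χ) → ev f φ ≡ ev g φ
  ev-cong (var n) h = h (here refl)
  ev-cong ⊤' h = refl
  ev-cong (¬' φ) h = cong not (ev-cong φ h)
  ev-cong (φ ∧' ψ) h =
    cong₂ _∧_ (ev-cong φ (h ∘ ∈-++⁺ˡ)) (ev-cong ψ (h ∘ ∈-++⁺ʳ (atoms φ)))
  ev-cong ([ α ] φ) h = h (here refl)

  ev-substP : ∀ f σ τ → ev f (substP σ τ) ≡ evalP (ev f ∘ σ) τ
  ev-substP f σ (pvar n) = refl
  ev-substP f σ p⊤ = refl
  ev-substP f σ (p¬ τ) = cong not (ev-substP f σ τ)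
  ev-substP f σ (τ p∧ υ) = cong₂ _∧_ (ev-substP f σ τ) (ev-substP f σ υ)

  modality-free-soundness : ∀ {φ} → GLP (_∈ []) φ → ∀ f → Holds f φ
  modality-free-soundness (taut {τ} σ h p) f = hold (trans (ev-substP f σ τ) (h (ev f ∘ σ)))
  modality-free-soundness (ax-K α χ ψ ((() , _) , _)) f
  modality-free-soundness (ax-L α χ ((() , _) , _)) f
  modality-free-soundness (ax-3 α β χ α≤β ((() , _) , _)) f
  modality-free-soundness (ax-4 α β χ α<β ((() , _) , _)) f
  modality-free-soundness (ax-5 α β χ α≤β ((() , _) , _)) f
  modality-free-soundness (mp d e) f =
    ⇒E (modality-free-soundness e f) (modality-free-soundness d f)
  modality-free-soundness (nec α (() , _) d) f

  modality-free-decidable : ∀ φ → InL (_∈ []) φ → GLP (_∈ []) φ ⊎ ¬ GLP (_∈ []) φ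
  modality-free-decidable φ p with search (valuations (atoms φ)) (λ {u} _ → attempt u)
    where
    attempt : ∀ u → (¬ Holds u φ) ⊎ Holds u φ
    attempt u with ev u φ in eq
    ... | true = inj₂ (hold eq)
    ... | false = inj₁ λ h → true≢false (holds h) eq
  ... | inj₁ (u , _ , ¬h) = inj₂ λ d → ¬h (modality-free-soundness d u)
  ... | inj₂ h = inj₁ (tautology p λ f →
    let (u , u∈ , u≗f) = valuations-complete f (atoms φ) in
    hold (trans (sym (ev-cong φ u≗f)) (holds (h u∈))))

  -- The two boxes differ when S lacks the least element of T. The hypothesis box χ is needed since
  -- planes are described by such formulas. For S = T this is decidability.
  conservative : ∀ T → AllPairs _<_ T → ∀ {S} → S ⊆ T → ∀ χ φ → InL (_∈ S) χ → InL (_∈ S) φ →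
                 GLP (_∈ S) (box S χ ⇒ φ) ⊎ ¬ GLP (_∈ T) (box T χ ⇒ φ)
  conservative [] _ [] χ φ p q = modality-free-decidable (⊤' ⇒ φ) (_ , q)
  conservative (t ∷ T) (t<T ∷ T-sorted) S⊆ = extend S⊆
    where
    open Collapse t T t<T T-sorted

    -- Decidability over T is the induction hypothesis with S equal to T and a trivial boxed
    -- hypothesis.
    dec : ∀ φ → Dec (⊢ φ)
    dec φ with InL? (_∈? T) φ
    ... | no ¬p = no (¬p ∘ GLP-InL)
    ... | yes p with conservative T T-sorted ⊆-refl ⊤' φ _ p
    ...   | inj₁ d = yes (mp (box-nec T id (tautology _ λ f → ⊤I)) d)
    ...   | inj₂ ¬d = no (¬d ∘ weaken (box T ⊤') (InL-box T id _))

    ≢t : ∀ {α} → α ∈ T → α ≢ t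
    ≢t α∈ refl = irrefl refl (All.lookup t<T α∈)

    extend : ∀ {S} → S ⊆ t ∷ T → ∀ χ φ → InL (_∈ S) χ → InL (_∈ S) φ →
             GLP (_∈ S) (box S χ ⇒ φ) ⊎ (¬ (⊢⁺ [ t ] χ ⇒ φ))
    extend {S} (_ ∷ʳ S⊆T) χ φ p q with conservative T T-sorted S⊆T χ φ p q
    ... | inj₁ d = inj₁ d
    ... | inj₂ ¬d = inj₂ (¬d ∘ reflect)
      where
      -- With t outside S a single plane suffices: no `[ t ] ψ` is false, so the tree has no
      -- children.
      u : Form → Bool
      u _ = true
      fixed : ∀ w ψ → InL (_∈ S) ψ → (w *) ψ ≡ ψ
      fixed w ψ r = collapse-id t w ψ (λ α∈ → ≢t (lookup S⊆T α∈)) r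
      only-χ : ∀ {ψ} → ψ ∈ χ ∷ [] → InL (_∈ S) ψ
      only-χ (here refl) = p
      χ-InL = InL-map (lookup S⊆T) χ p
      χ⇒χ : ⊢ χ ⇒ (u *) χ ∧' ⊤'
      χ⇒χ rewrite fixed u χ p = tautology (χ-InL , χ-InL , _) (λ f → ⇒I λ x → ∧I x ⊤I)
      conclude : (Σ (Form → Bool) λ w → (∀ {ψ} → ψ ∈ χ ∷ [] → w ψ ≡ true) ×
                    ⊢ box T ((u *) χ ∧' ⊤') ⇒ (w *) ([ t ] χ ⇒ φ)) →
                 ⊢ box T χ ⇒ φ
      conclude (w , wχ , e) =
        conseq (e ∷ box-mono T id χ⇒χ ∷ []) (InL-box T id χ-InL , InL-map (lookup S⊆T) φ q)
          λ { f (h ∷ k ∷ []) → ⇒I λ x →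
              subst (Holds f) (fixed w φ q) (⇒E (⇒E h (⇒E k x)) (boxed f)) }
        where
        boxed : ∀ f → Holds f ((w *) ([ t ] χ))
        boxed f rewrite collapse-box-const t w χ = const⁺ (wχ (here refl))
      reflect : ⊢⁺ [ t ] χ ⇒ φ → ⊢ box T χ ⇒ φ
      reflect d = conclude
        (descend {u} (realisable (λ _ ()) (λ _ ()) (λ _ ()) (λ _ ())) d (All.tabulate id))
        where
        open Tower dec (ax5-bodies d) (χ ∷ []) (All.lookup (InL-ax5-bodies d))
          (λ {ψ} ψ∈ → InL-map (there ∘ lookup S⊆T) ψ (only-χ ψ∈))
          (λ {w} {v} _ {ψ} ψ∈ → trans (fixed w ψ (only-χ ψ∈)) (sym (fixed v ψ (only-χ ψ∈))))
    extend {.t ∷ S} (refl ∷ S⊆T) χ φ p q with completeness ([ t ] χ ⇒ φ) ((here refl , p) , q) id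
      where
      open Completeness S (λ α∈ → All.lookup t<T (lookup S⊆T α∈)) (conservative T T-sorted S⊆T)
        (bodies ([ t ] χ ⇒ φ)) (InL-bodies ([ t ] χ ⇒ φ) ((here refl , p) , q))
        (bodies-trans ([ t ] χ ⇒ φ))
    ... | inj₂ d = inj₁ d
    ... | inj₁ (u , R , ¬d) = inj₂ refuted
      where
      Ψ = bodies ([ t ] χ ⇒ φ)
      conclude : (Σ (Form → Bool) λ w → (∀ {ψ} → ψ ∈ Ψ → w ψ ≡ u ψ) ×
                    ⊢ box T (conj u (u *) Ψ) ⇒ (w *) ([ t ] χ ⇒ φ)) → ⊥
      -- The realised valuation agrees with u on Ψ, so the derivation would prove the very collapse
      -- that the countermodel refutes.
      conclude (w , w≈u , e) = ¬d (subst (λ ψ → ⊢ box T (conj u (u *) Ψ) ⇒ ψ)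
        (collapse-cong t ([ t ] χ ⇒ φ) w≈u) e)
      refuted : ¬ (⊢⁺ [ t ] χ ⇒ φ)
      refuted d = conclude (descend R d (All.tabulate id))
        where
        open Tower dec (ax5-bodies d) Ψ (All.lookup (InL-ax5-bodies d))
          (InL-bodies ([ t ] χ ⇒ φ) (GLP-InL d))
          (λ w≈v {ψ} ψ∈ → collapse-cong t ψ (λ ξ∈ → w≈v (bodies-trans ([ t ] χ ⇒ φ) ψ∈ ξ∈)))

  -- Finite supports, sorted lists, and the passage to arbitrary sets of modalities.

  modalities : Form → List Carrier
  modalities (var n)   = []
  modalities ⊤'        = []
  modalities (¬' φ)    = modalities φ
  modalities (φ ∧' ψ)  = modalities φ ++ modalities ψ
  modalities ([ α ] φ) = α ∷ modalities φ

  InL-modalities : ∀ {s} {S : Carrier → Set s} φ → (∀ {α} → α ∈ modalities φ → S α) → InL S φ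
  InL-modalities (var n) h = _
  InL-modalities ⊤' h = _
  InL-modalities (¬' φ) h = InL-modalities φ h
  InL-modalities (φ ∧' ψ) h =
    InL-modalities φ (h ∘ ∈-++⁺ˡ) , InL-modalities ψ (h ∘ ∈-++⁺ʳ (modalities φ))
  InL-modalities ([ α ] φ) h = h (here refl) , InL-modalities φ (h ∘ there)

  modalities-InL : ∀ {s} {S : Carrier → Set s} φ → InL S φ → ∀ {α} → α ∈ modalities φ → S α
  modalities-InL (¬' φ) p α∈ = modalities-InL φ p α∈
  modalities-InL (φ ∧' ψ) (p , q) α∈ with ∈-++⁻ (modalities φ) α∈
  ... | inj₁ α∈φ = modalities-InL φ p α∈φ
  ... | inj₂ α∈ψ = modalities-InL ψ q α∈ψ
  modalities-InL ([ α ] φ) (p , q) (here refl) = p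
  modalities-InL ([ α ] φ) (p , q) (there α∈) = modalities-InL φ q α∈

  -- Each axiom contributes the modalities occurring in it, and each necessitation its own modality.
  finite-support : ∀ {s} {S : Carrier → Set s} {φ} → GLP S φ →
                   Σ (List Carrier) λ L → GLP (_∈ L) φ
  finite-support (taut {τ} σ h p) = _ , taut {t = τ} σ h (InL-modalities (substP σ τ) id)
  finite-support {φ = φ} (ax-K α χ ψ p) = _ , ax-K α χ ψ (InL-modalities φ id)
  finite-support {φ = φ} (ax-L α χ p) = _ , ax-L α χ (InL-modalities φ id)
  finite-support {φ = φ} (ax-3 α β χ α≤β p) = _ , ax-3 α β χ α≤β (InL-modalities φ id)
  finite-support {φ = φ} (ax-4 α β χ α<β p) = _ , ax-4 α β χ α<β (InL-modalities φ id)
  finite-support {φ = φ} (ax-5 α β χ α≤β p) = _ , ax-5 α β χ α≤β (InL-modalities φ id)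
  finite-support (mp d e) with finite-support d | finite-support e
  ... | L , d′ | M , e′ = L ++ M , mp (GLP-map ∈-++⁺ˡ d′) (GLP-map (∈-++⁺ʳ L) e′)
  finite-support (nec {χ} α p d) with finite-support d
  ... | L , d′ = α ∷ L , nec α (here refl , InL-map there χ (GLP-InL d′)) (GLP-map there d′)

  -- An element already present is not repeated, because the lists are strictly increasing.
  insert : Carrier → List Carrier → List Carrier
  insert α [] = α ∷ []
  insert α (β ∷ L) with compare α β
  ... | tri< _ _ _ = α ∷ β ∷ L
  ... | tri≈ _ _ _ = β ∷ L
  ... | tri> _ _ _ = β ∷ insert α L

  insert⁺-here : ∀ α L → α ∈ insert α L
  insert⁺-here α [] = here refl
  insert⁺-here α (β ∷ L) with compare α β
  ... | tri< _ _ _ = here refl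
  ... | tri≈ _ α≡β _ = here α≡β
  ... | tri> _ _ _ = there (insert⁺-here α L)

  insert⁺-there : ∀ α L {β} → β ∈ L → β ∈ insert α L
  insert⁺-there α (β ∷ L) β∈ with compare α β
  insert⁺-there α (β ∷ L) β∈ | tri< _ _ _ = there β∈
  insert⁺-there α (β ∷ L) β∈ | tri≈ _ _ _ = β∈
  insert⁺-there α (β ∷ L) (here refl) | tri> _ _ _ = here refl
  insert⁺-there α (β ∷ L) (there β∈) | tri> _ _ _ = there (insert⁺-there α L β∈)

  insert-All : ∀ {p} {P : Carrier → Set p} {α} → P α → ∀ {L} → All P L → All P (insert α L)
  insert-All pα [] = pα ∷ []
  insert-All {α = α} pα {β ∷ L} (pβ ∷ ps) with compare α β
  ... | tri< _ _ _ = pα ∷ pβ ∷ ps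
  ... | tri≈ _ _ _ = pβ ∷ ps
  ... | tri> _ _ _ = pβ ∷ insert-All pα ps

  insert-sorted : ∀ α {L} → AllPairs _<_ L → AllPairs _<_ (insert α L)
  insert-sorted α [] = [] ∷ []
  insert-sorted α {β ∷ L} (β<L ∷ L-sorted) with compare α β
  ... | tri< α<β _ _ = (α<β ∷ All.map (<-trans α<β) β<L) ∷ β<L ∷ L-sorted
  ... | tri≈ _ _ _ = β<L ∷ L-sorted
  ... | tri> _ _ β<α = insert-All β<α β<L ∷ insert-sorted α L-sorted

  sort : List Carrier → List Carrier
  sort = foldr insert []

  sort-sorted : ∀ L → AllPairs _<_ (sort L)
  sort-sorted [] = []
  sort-sorted (α ∷ L) = insert-sorted α (sort-sorted L)

  sort⁺ : ∀ {L α} → α ∈ L → α ∈ sort L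
  sort⁺ {_ ∷ L} (here refl) = insert⁺-here _ (sort L)
  sort⁺ {β ∷ L} (there α∈) = insert⁺-there β (sort L) (sort⁺ α∈)

  -- The finite theorem is applied to the modalities of φ inside a finite support, so membership in
  -- S never has to be decided. The result then maps into S because φ lies in its language.
  restrict : ∀ {r s} {R : Carrier → Set r} {S : Carrier → Set s} {φ} →
             InL S φ → GLP R φ → GLP S φ
  restrict {S = S} {φ = φ} p d with finite-support d
  ... | L , d′ = GLP-map (λ α∈ → modalities-InL φ p (proj₂ (∈-filter⁻ φ? {xs = T} α∈))) finite
    where
    φ? : ∀ α → Dec (α ∈ modalities φ)
    φ? α = α ∈? modalities φ
    T = sort (modalities φ ++ L)
    M = filter φ? T
    φ-InL : InL (_∈ M) φ
    φ-InL = InL-modalities φ (λ α∈ → ∈-filter⁺ φ? (sort⁺ (∈-++⁺ˡ α∈)) α∈)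
    finite : GLP (_∈ M) φ
    finite with conservative T (sort-sorted (modalities φ ++ L)) (filter-⊆ φ? T) ⊤' φ _ φ-InL
    ... | inj₁ e = mp (box-nec M id (tautology _ λ f → ⊤I)) e
    ... | inj₂ ¬e = ⊥-elim (¬e (weaken (box T ⊤') (InL-box T id _)
                      (GLP-map (sort⁺ ∘ ∈-++⁺ʳ (modalities φ)) d′)))

mainTheorem1 : {a ℓ s : Level} (Λ : LinearOrder a ℓ) (S : LinearOrder.Carrier Λ → Set s)
    (φ : GLPLogic.Form Λ) → GLPLogic.InL Λ S φ →
    GLPLogic.GLPΛ Λ φ ⇔ GLPLogic.GLP Λ S φ
mainTheorem1 Λ S φ p = mk⇔ (restrict p) (GLP-map _)
  where open Conservativity Λ
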